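{- Let $\mathcal{CS}$ be a variant closed and axiomatically appropriate constant specification. For every closed formula $\varphi$ of the basic language $\mathit{Fml}_J$, if $\varphi$ is valid in every Fitting model for FOLPb meeting $\mathcal{CS}$, then $\vdash_{\mathcal{CS}}\varphi$.
   Context: Syntax of FOLPb. Basic individual variables $x_0,x_1,\dots$; predicate symbols; primitive connectives $\to,\bot,\forall$; justification variables $p_i$ and constants $c_i$. Terms: $t::=p_i\mid c\mid (t\cdot t)\mid (t+t)\mid\, !t\mid \mathsf{b}(t)\mid \mathsf{gen}_x(t)$. Formulas: $\varphi::=Px_1\dots x_n\mid\bot\mid(\varphi\to\varphi)\mid\forall x\varphi\mid t{:}_X\varphi$, $X$ a finite set of individual variables; $fv(t{:}_X\psi)=X$ (the free occurrences in $t{:}_X\psi$ are the free occurrences in $\psi$ of variables in $X$ plus those in $X$). $Xy$ denotes $X\cup\{y\}$, $y\notin X$. Axioms of $\mathsf{FOLPb}_0$: A1 classical first-order axioms; A2 $t{:}_{Xy}\varphi\to t{:}_X\varphi$ if $y$ not free in $\varphi$; A3 $t{:}_X\varphi\to t{:}_{Xy}\varphi$; B1 $t{:}_X\varphi\to\varphi$; B2 $t{:}_X(\varphi\to\psi)\to(s{:}_X\varphi\to[t\cdot s]{:}_X\psi)$; B3 $t{:}_X\varphi\to[t+s]{:}_X\varphi$, $s{:}_X\varphi\to[t+s]{:}_X\varphi$; B4 $t{:}_X\varphi\to\,!t{:}_Xt{:}_X\varphi$; B5 $t{:}_X\varphi\to\mathsf{gen}_x(t){:}_X\forall x\varphi$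 if $x\notin X$; Bb $\forall y\,t{:}_{Xy}\varphi(y)\to\mathsf b(t){:}_X\forall y\varphi(y)$; rules modus ponens and generalization. A constant specification $\mathcal{CS}$ is a set of formulas $c{:}\psi$, $\psi$ an axiom, $c$ a constant; it is axiomatically appropriate if every axiom $\psi$ has some $c$ with $c{:}\psi\in\mathcal{CS}$; it is variant closed if whenever $\varphi,\psi$ are variable variants (each obtained from the other by a one-to-one, onto renaming of free individual variables) then $c{:}\varphi\in\mathcal{CS}$ iff $c{:}\psi\in\mathcal{CS}$. $\vdash_{\mathcal{CS}}$ is provability in $\mathsf{FOLPb}_0$ plus $\mathcal{CS}$ as axioms. Semantics. A $\mathcal D$-formula results from a formula by substituting elements of a nonempty set $\mathcal D$ for free variable occurrences; closed if no free variables remain. A Fitting model $\langle\mathcal W,\mathcal R,\mathcal D,\mathcal I,\mathcal E\rangle$: $\mathcal W\neq\emptyset$, $\mathcal R\subseteq\mathcal W^2$, $\mathcal I(P,w)\subseteq\mathcal D^n$, $\mathcal E(t,\varphi)\subseteq\mathcal W$ for terms $t$ and $\mathcal D$-formulas $\varphi$ with: $\mathcal E(t,\varphi\to\psi)\cap\mathcal E(s,\varphi)\subseteq\mathcal E(t\cdot s,\psi)$; $\mathcal E(s,\varphi)\cup\mathcal E(t,\varphi)\subseteq\mathcal E(s+t,\varphi)$; $\mathcal E(t,\varphi)\subseteq\mathcal E(!t,t{:}_X\varphi)$ for $X\subseteq\mathcal D$ containing the elements in $\varphi$; $\mathcal E(t,\varphi)$ closed upward under $\mathcal R$; $w\in\mathcal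 E(t,\varphi(x))$ implies $w\in\mathcal E(t,\varphi(a))$ for $a\in\mathcal D$; $\mathcal E(t,\varphi)\subseteq\mathcal E(\mathsf{gen}_x(t),\forall x\varphi)$; if $w\in\mathcal E(t,\varphi(a))$ for all $a\in\mathcal D$ then $w\in\mathcal E(\mathsf b(t),\forall y\varphi(y))$. It meets $\mathcal{CS}$ if $\mathcal E(c,\varphi)=\mathcal W$ for $c{:}\varphi\in\mathcal{CS}$. Truth: atomic via $\mathcal I$, $\bot$ false, $\to$ classical, $\forall x\psi$ true iff $\psi(a)$ true for all $a\in\mathcal D$; $w\Vdash t{:}_X\psi(\vec x)$ ($\vec x$ the free variables of $\psi$) iff $w\in\mathcal E(t,\psi(\vec x))$ and $w'\Vdash\psi(\vec a)$ for all $w'$ with $w\mathcal Rw'$ and all $\vec a\in\mathcal D$. Valid in a model: true at all worlds. A Fitting model for FOLPb has $\mathcal R$ reflexive and transitive. -}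

module Defs where

open import Data.Bool using (if_then_else_)
open import Data.Empty using (⊥; ⊥-elim)
open import Data.List using (List; []; _∷_; map)
open import Data.List.Membership.Propositional using (_∈_; _∉_)
open import Data.List.Relation.Binary.BagAndSetEquality using (_∼[_]_; set)
open import Data.List.Relation.Unary.Any using (any?)
open import Data.Maybe using (Maybe; maybe′)
open import Data.Nat using (ℕ; _≟_)
open import Data.Product using (∃; ∃-syntax; _×_)
open import Data.Sum using (_⊎_)
open import Data.Unit using (⊤)
open import Data.Vec using (Vec)
import Data.Vec as Vec
import Data.Vec.Membership.Propositional as Vec
open import Function.Bundles using (_↔_; _↣_; _⇔_; Inverse)
open import Relation.Binary.Definitions using (Reflexive; Transitive)
open import Relation.Binary.PropositionalEquality using (_≡_; _≢_; refl; cong)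
open import Relation.Nullary using (¬_; Dec; yes; no; does)

-- Individual variables xᵢ, justification variables pᵢ and constants cᵢ are
-- represented by their indices.

infixl 7 _·_
infixl 6 _∔_
infix  8 !_

data Term : Set where
  pvar : ℕ → Term
  con  : ℕ → Term
  _·_  : Term → Term → Term
  _∔_  : Term → Term → Term
  !_   : Term → Term
  𝖻    : Term → Term
  gen  : ℕ → Term → Term

record Signature : Set₁ where
  field
    Pred      : Set
    arity     : Pred → ℕ
    countable : Pred ↣ ℕ

open Signature public

data Ind (D : Set) : Set where
  var  : ℕ → Ind D
  elem : D → Ind D

-- Formulas whose free occurrences may be filled with elements of D.  The
-- index of a justification assertion is a finite set; it is given by a list,
-- and formulas are identified up to the relation _≈_ below.

infix  9 _∶[_]_
infixr 5 _⇒_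
infix  8 ∀[_]_

data Formula (L : Signature) (D : Set) : Set where
  atom   : (P : Pred L) → Vec (Ind D) (arity L P) → Formula L D
  ⊥ᶠ     : Formula L D
  _⇒_    : Formula L D → Formula L D → Formula L D
  ∀[_]_  : ℕ → Formula L D → Formula L D
  _∶[_]_ : Term → List (Ind D) → Formula L D → Formula L D

Fml : Signature → Set
Fml L = Formula L ⊥

-- Identity of formulas when the indices X are read as sets.

infix 4 _≈_

data _≈_ {L : Signature} {D : Set} : Formula L D → Formula L D → Set where
  atom : ∀ P is → atom P is ≈ atom P is
  ⊥ᶠ   : ⊥ᶠ ≈ ⊥ᶠ
  _⇒_  : ∀ {φ φ′ ψ ψ′} → φ ≈ φ′ → ψ ≈ ψ′ → φ ⇒ ψ ≈ φ′ ⇒ ψ′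
  all  : ∀ x {φ φ′} → φ ≈ φ′ → ∀[ x ] φ ≈ ∀[ x ] φ′
  just : ∀ t {X X′ φ φ′} → X ∼[ set ] X′ → φ ≈ φ′ → t ∶[ X ] φ ≈ t ∶[ X′ ] φ′

infix 4 _∈fv_ _∉fv_ _occursIn_

_∈fv_ : ∀ {L D} → ℕ → Formula L D → Set
x ∈fv atom P is    = var x Vec.∈ is
x ∈fv ⊥ᶠ           = ⊥
x ∈fv (φ ⇒ ψ)      = x ∈fv φ ⊎ x ∈fv ψ
x ∈fv (∀[ y ] φ)   = x ≢ y × x ∈fv φ
x ∈fv (t ∶[ X ] φ) = var x ∈ X

_∉fv_ : ∀ {L D} → ℕ → Formula L D → Set
x ∉fv φ = ¬ (x ∈fv φ)

Closed : ∀ {L D} → Formula L D → Set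
Closed φ = ∀ x → x ∉fv φ

_occursIn_ : ∀ {L D} → D → Formula L D → Set
a occursIn atom P is    = elem a Vec.∈ is
a occursIn ⊥ᶠ           = ⊥
a occursIn (φ ⇒ ψ)      = a occursIn φ ⊎ a occursIn ψ
a occursIn (∀[ y ] φ)   = a occursIn φ
a occursIn (t ∶[ X ] φ) = elem a ∈ X ⊎ a occursIn φ

var≟ : ∀ {D} (x : ℕ) (i : Ind D) → Dec (var x ≡ i)
var≟ x (elem a) = no λ ()
var≟ x (var y) with x ≟ y
... | yes x≡y = yes (cong var x≡y)
... | no  x≢y = no λ { refl → x≢y refl }

_var∈?_ : ∀ {D} (x : ℕ) (X : List (Ind D)) → Dec (var x ∈ X)
x var∈? X = any? (var≟ x) X

-- The substitution that acts as σ on the variables in X and as the identity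
-- on all others.

_↾_ : ∀ {D} → (ℕ → Ind D) → List (Ind D) → ℕ → Ind D
(σ ↾ X) x = if does (x var∈? X) then σ x else var x

_[_↦_] : ∀ {A : Set} → (ℕ → A) → ℕ → A → ℕ → A
(σ [ x ↦ i ]) y = if does (y ≟ x) then i else σ y

subᵢ : ∀ {D} → (ℕ → Ind D) → Ind D → Ind D
subᵢ σ (var x)  = σ x
subᵢ σ (elem a) = elem a

-- Simultaneous replacement of free occurrences.  There is no renaming of
-- bound variables, so capture has to be excluded separately (see FreeFor).

infixl 10 _⟦_⟧ _⟦_≔_⟧

_⟦_⟧ : ∀ {L D} → Formula L D → (ℕ → Ind D) → Formula L D
atom P is    ⟦ σ ⟧ = atom P (Vec.map (subᵢ σ) is)
⊥ᶠ           ⟦ σ ⟧ = ⊥ᶠ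
(φ ⇒ ψ)      ⟦ σ ⟧ = φ ⟦ σ ⟧ ⇒ ψ ⟦ σ ⟧
(∀[ x ] φ)   ⟦ σ ⟧ = ∀[ x ] (φ ⟦ σ [ x ↦ var x ] ⟧)
(t ∶[ X ] φ) ⟦ σ ⟧ = t ∶[ map (subᵢ σ) X ] (φ ⟦ σ ↾ X ⟧)

_⟦_≔_⟧ : ∀ {L D} → Formula L D → ℕ → Ind D → Formula L D
φ ⟦ x ≔ i ⟧ = φ ⟦ var [ x ↦ i ] ⟧

-- y is free for x in φ.  A variable of ψ outside X is bound in t ∶[ X ] ψ;
-- so if x ∈ X, putting y for x captures when y is free in ψ but not in X.

FreeFor : ∀ {L D} → ℕ → ℕ → Formula L D → Set
FreeFor y x (atom P is)  = ⊤
FreeFor y x ⊥ᶠ           = ⊤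
FreeFor y x (φ ⇒ ψ)      = FreeFor y x φ × FreeFor y x ψ
FreeFor y x (∀[ z ] φ)   = x ∈fv (∀[ z ] φ) → y ≢ z × FreeFor y x φ
FreeFor y x (t ∶[ X ] φ) = var x ∈ X → (y ∈fv φ → var y ∈ X) × FreeFor y x φ

embedᵢ : ∀ {D} → Ind ⊥ → Ind D
embedᵢ (var x)  = var x
embedᵢ (elem a) = ⊥-elim a

embed : ∀ {L D} → Fml L → Formula L D
embed (atom P is)  = atom P (Vec.map embedᵢ is)
embed ⊥ᶠ           = ⊥ᶠ
embed (φ ⇒ ψ)      = embed φ ⇒ embed ψ
embed (∀[ x ] φ)   = ∀[ x ] embed φ
embed (t ∶[ X ] φ) = t ∶[ map embedᵢ X ] embed φ

-- σ x = nothing leaves x in place.  Not every Formula L D is a D-formula: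
-- t ∶[ [] ] φ with an element of D in φ is not.

IsDFormula : ∀ {L D} → Formula L D → Set
IsDFormula {D = D} χ = ∃[ φ ] ∃ λ (σ : ℕ → Maybe D) →
  χ ≈ embed φ ⟦ (λ x → maybe′ elem (var x) (σ x)) ⟧

-- A1-* is a Hilbert axiomatisation of classical first-order logic in →, ⊥, ∀.

data Axiom {L : Signature} : Fml L → Set where
  A1-K    : ∀ φ ψ → Axiom (φ ⇒ ψ ⇒ φ)
  A1-S    : ∀ φ ψ χ → Axiom ((φ ⇒ ψ ⇒ χ) ⇒ (φ ⇒ ψ) ⇒ φ ⇒ χ)
  A1-DN   : ∀ φ → Axiom (((φ ⇒ ⊥ᶠ) ⇒ ⊥ᶠ) ⇒ φ)
  A1-inst : ∀ x y φ → FreeFor y x φ → Axiom (∀[ x ] φ ⇒ φ ⟦ x ≔ var y ⟧)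
  A1-dist : ∀ x φ ψ → x ∉fv φ → Axiom (∀[ x ] (φ ⇒ ψ) ⇒ φ ⇒ ∀[ x ] ψ)
  A2  : ∀ t X y φ → var y ∉ X → y ∉fv φ →
        Axiom (t ∶[ var y ∷ X ] φ ⇒ t ∶[ X ] φ)
  A3  : ∀ t X y φ → var y ∉ X →
        Axiom (t ∶[ X ] φ ⇒ t ∶[ var y ∷ X ] φ)
  B1  : ∀ t X φ → Axiom (t ∶[ X ] φ ⇒ φ)
  B2  : ∀ t s X φ ψ →
        Axiom (t ∶[ X ] (φ ⇒ ψ) ⇒ s ∶[ X ] φ ⇒ (t · s) ∶[ X ] ψ)
  B3ˡ : ∀ t s X φ → Axiom (t ∶[ X ] φ ⇒ (t ∔ s) ∶[ X ] φ)
  B3ʳ : ∀ t s X φ → Axiom (s ∶[ X ] φ ⇒ (t ∔ s) ∶[ X ] φ)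
  B4  : ∀ t X φ → Axiom (t ∶[ X ] φ ⇒ (! t) ∶[ X ] (t ∶[ X ] φ))
  B5  : ∀ t X x φ → var x ∉ X →
        Axiom (t ∶[ X ] φ ⇒ gen x t ∶[ X ] (∀[ x ] φ))
  Bb  : ∀ t X y φ → var y ∉ X →
        Axiom (∀[ y ] (t ∶[ var y ∷ X ] φ) ⇒ 𝖻 t ∶[ X ] (∀[ y ] φ))
  ax-≈ : ∀ {φ ψ} → φ ≈ ψ → Axiom φ → Axiom ψ

-- Spec c ψ means that c:ψ, i.e. con c ∶[ [] ] ψ, belongs to the specification.

record ConstantSpecification (L : Signature) : Set₁ where
  field
    Spec   : ℕ → Fml L → Set
    axiom  : ∀ {c ψ} → Spec c ψ → Axiom ψ
    resp-≈ : ∀ {c φ ψ} → φ ≈ ψ → Spec c φ → Spec c ψ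

open ConstantSpecification public using (Spec)

AxiomaticallyAppropriate : ∀ {L} → ConstantSpecification L → Set
AxiomaticallyAppropriate CS = ∀ {ψ} → Axiom ψ → ∃[ c ] Spec CS c ψ

-- A bijection between the (finite) sets of free variables is the same as the
-- restriction of a permutation of all variables.  Requiring both directions
-- excludes capture.

Variant : ∀ {L} → Fml L → Fml L → Set
Variant φ ψ = ∃ λ (π : ℕ ↔ ℕ) →
  (ψ ≈ φ ⟦ (λ x → var (Inverse.to π x)) ⟧) ×
  (φ ≈ ψ ⟦ (λ x → var (Inverse.from π x)) ⟧)

VariantClosed : ∀ {L} → ConstantSpecification L → Set
VariantClosed CS = ∀ {c φ ψ} → Variant φ ψ → Spec CS c φ ⇔ Spec CS c ψ

infix 3 _⊢_

data _⊢_ {L : Signature} (CS : ConstantSpecification L) : Fml L → Set where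
  ax  : ∀ {φ} → Axiom φ → CS ⊢ φ
  cs  : ∀ {c ψ} → Spec CS c ψ → CS ⊢ con c ∶[ [] ] ψ
  mp  : ∀ {φ ψ} → CS ⊢ φ ⇒ ψ → CS ⊢ φ → CS ⊢ ψ
  gen : ∀ x {φ} → CS ⊢ φ → CS ⊢ ∀[ x ] φ

-- E t φ w means w ∈ 𝓔(t, φ).  It is constrained, and matters for truth, only
-- when φ is a D-formula.

record FittingModel (L : Signature) : Set₁ where
  field
    W  : Set
    w₀ : W
    R  : W → W → Set
    D  : Set
    d₀ : D
    I  : (P : Pred L) → W → Vec D (arity L P) → Set
    E  : Term → Formula L D → W → Set

    E-≈    : ∀ {t φ ψ w} → IsDFormula φ → φ ≈ ψ → E t φ w → E t ψ w
    E-·    : ∀ {t s φ ψ w} → IsDFormula (φ ⇒ ψ) →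
             E t (φ ⇒ ψ) w → E s φ w → E (t · s) ψ w
    E-∔    : ∀ {s t φ w} → IsDFormula φ → E s φ w ⊎ E t φ w → E (s ∔ t) φ w
    E-!    : ∀ {t φ w} (X : List D) → IsDFormula φ →
             (∀ a → a occursIn φ → a ∈ X) →
             E t φ w → E (! t) (t ∶[ map elem X ] φ) w
    E-R    : ∀ {t φ w w′} → IsDFormula φ → R w w′ → E t φ w → E t φ w′
    E-inst : ∀ {t φ w} x a → IsDFormula φ → E t φ w → E t (φ ⟦ x ≔ elem a ⟧) w
    E-gen  : ∀ {t φ w} x → IsDFormula φ → E t φ w → E (gen x t) (∀[ x ] φ) w
    E-𝖻    : ∀ {t φ w} y → IsDFormula φ →
             (∀ a → E t (φ ⟦ y ≔ elem a ⟧) w) → E (𝖻 t) (∀[ y ] φ) w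

module _ {L : Signature} (M : FittingModel L) where
  open FittingModel M

  IsFOLPbModel : Set
  IsFOLPbModel = Reflexive R × Transitive R

  Meets : ConstantSpecification L → Set
  Meets CS = ∀ {c φ} → Spec CS c φ → ∀ w → E (con c) (embed φ) w

  value : (ℕ → D) → Ind D → D
  value ρ (var x)  = ρ x
  value ρ (elem a) = a

  -- Truth at w of the closed D-formula obtained from φ by putting ρ x for
  -- each free x.  For t ∶[ X ] ψ, only the variables in X get their value
  -- from ρ in ψ; the other free variables of ψ stay variables in the evidence
  -- clause and range over all of D in the second clause.

  Truth : W → Formula L D → (ℕ → D) → Set
  Truth w (atom P is)  ρ = I P w (Vec.map (value ρ) is)
  Truth w ⊥ᶠ           ρ = ⊥
  Truth w (φ ⇒ ψ)      ρ = Truth w φ ρ → Truth w ψ ρ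
  Truth w (∀[ x ] ψ)   ρ = ∀ a → Truth w ψ (ρ [ x ↦ a ])
  Truth w (t ∶[ X ] ψ) ρ =
    E t (ψ ⟦ (λ x → elem (ρ x)) ↾ X ⟧) w ×
    (∀ w′ → R w w′ → (ρ′ : ℕ → D) → (∀ x → var x ∈ X → ρ′ x ≡ ρ x) →
      Truth w′ ψ ρ′)

  -- For a closed formula the choice of ρ is immaterial.

  Valid : Fml L → Set
  Valid φ = ∀ w ρ → Truth w (embed φ) ρ

{-# OPTIONS --safe #-}
module Submission where

-- A Henkin construction with a single world.  If φ is not provable, {¬φ} is
-- extended to a consistent theory Th of formulas with parameters from ℕ that
-- decides every sentence and has a counterexample to every refuted ∀.  Take
-- D = ℕ, one world, and let t be evidence for ψ when Th contains t:_X ψ, with X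
-- the elements of ψ.  The evidence clause alone refutes t:_X ψ when Th does not
-- contain it, so no further worlds are needed; when Th contains it, B1 and
-- generalization give all instances of ψ.  Besides the truth of ∀, the
-- counterexamples serve the evidence condition for 𝖻: if Th contains
-- t:_{Xa} ψ(a) for all a, it contains ∀y t:_{Xy} ψ(y), and Bb applies.
--
-- Bound variables cannot be renamed to make room for parameters, because x
-- occurs in the term gen x t.  Instead, a formula with parameters counts as
-- derivable when, for all large N, it becomes provable on putting the variable
-- a + N for each parameter a.

open import Defs
open import Axiom.ExcludedMiddle using (ExcludedMiddle)
open import Data.Empty using (⊥)
open import Data.List using (List; []; _∷_; _++_; map; upTo)
open import Data.List.Membership.Propositional using (_∈_; _∉_)
open import Data.List.Membership.Propositional.Properties using (∈-map⁺; ∈-map⁻; ∈-++⁺ˡ; ∈-++⁺ʳ; ∈-++⁻; ∈-upTo⁺)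
open import Data.List.Properties using (map-cong; map-∘; map-id-local; map-cong-local)
open import Data.List.Relation.Binary.BagAndSetEquality using (_∼[_]_; set)
open import Data.List.Relation.Binary.Subset.Propositional using (_⊆_)
open import Data.List.Relation.Binary.Subset.Propositional.Properties using (xs⊆xs++ys; xs⊆ys++xs) renaming (map⁺ to ⊆-map⁺)
open import Data.List.Relation.Unary.All as All using (All; []; _∷_)
open import Data.List.Relation.Unary.Any using (here; there)
open import Data.Nat using (ℕ; zero; suc; _+_; _<_; _≤_; _⊔_; _≟_; _<?_)
open import Data.Nat.Properties
open import Data.Product using (∃; _×_; _,_; proj₁; proj₂)
open import Data.Sum using (_⊎_; inj₁; inj₂; [_,_]′)
import Data.Sum as Sum
open import Data.Unit using (⊤; tt)
open import Data.Vec using (Vec; []; _∷_)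
import Data.Vec as Vec
import Data.Vec.Membership.Propositional as Vec
import Data.Vec.Membership.Propositional.Properties as Vec
import Data.Vec.Properties as Vec
open import Data.Vec.Relation.Unary.Any using (here; there)
open import Function using (_∘_; id)
open import Function.Bundles using (Injection; mk⇔; Equivalence)
open import Level using (0ℓ)
open import Relation.Binary.PropositionalEquality
open import Relation.Nullary using (¬_; yes; no; contradiction)
open import Relation.Nullary.Decidable using (dec-true; dec-false)

private variable
  L : Signature
  D : Set
  N x y z a : ℕ
  i : Ind D
  X : List (Ind D)

-- Substitution

update-≡ : ∀ {A : Set} (σ : ℕ → A) x {i} → (σ [ x ↦ i ]) x ≡ i
update-≡ σ x rewrite dec-true (x ≟ x) refl = refl

update-≢ : ∀ {A : Set} (σ : ℕ → A) {x y i} → y ≢ x → (σ [ x ↦ i ]) y ≡ σ y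
update-≢ σ {x} {y} y≢x rewrite dec-false (y ≟ x) y≢x = refl

restrict-∈ : (σ : ℕ → Ind D) → var x ∈ X → (σ ↾ X) x ≡ σ x
restrict-∈ {x = x} {X} σ x∈X rewrite dec-true (x var∈? X) x∈X = refl

restrict-∉ : (σ : ℕ → Ind D) → var x ∉ X → (σ ↾ X) x ≡ var x
restrict-∉ {x = x} {X} σ x∉X rewrite dec-false (x var∈? X) x∉X = refl

update-cong : (σ τ : ℕ → Ind D) → (y ≢ x → σ y ≡ τ y) → (σ [ x ↦ i ]) y ≡ (τ [ x ↦ i ]) y
update-cong {y = y} {x} σ τ e with y ≟ x
... | yes refl = trans (update-≡ σ y) (sym (update-≡ τ y))
... | no y≢x   = trans (update-≢ σ y≢x) (trans (e y≢x) (sym (update-≢ τ y≢x)))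

restrict-cong : ∀ (σ τ : ℕ → Ind D) X → (var x ∈ X → σ x ≡ τ x) → (σ ↾ X) x ≡ (τ ↾ X) x
restrict-cong {x = x} σ τ X e with x var∈? X
... | yes x∈X = e x∈X
... | no _    = refl

update-var : ∀ {D} x y → (var {D} [ x ↦ var x ]) y ≡ var y
update-var x y with y ≟ x
... | yes refl = update-≡ var y
... | no y≢x   = update-≢ var y≢x

restrict-var : (X : List (Ind D)) → ∀ x → (var ↾ X) x ≡ var x
restrict-var X x with x var∈? X
... | yes _ = refl
... | no _  = refl

subᵢ-cong : ∀ {σ τ : ℕ → Ind D} i → (∀ {x} → var x ≡ i → σ x ≡ τ x) → subᵢ σ i ≡ subᵢ τ i
subᵢ-cong (var x)  e = e refl
subᵢ-cong (elem a) e = refl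

subᵢ-var : (i : Ind D) → subᵢ var i ≡ i
subᵢ-var (var x)  = refl
subᵢ-var (elem a) = refl

vec-map-cong-∈ : ∀ {A B : Set} {f g : A → B} {n} (is : Vec A n) →
                 (∀ {i} → i Vec.∈ is → f i ≡ g i) → Vec.map f is ≡ Vec.map g is
vec-map-cong-∈ []       e = refl
vec-map-cong-∈ (i ∷ is) e = cong₂ _∷_ (e (here refl)) (vec-map-cong-∈ is (e ∘ there))

vec-∈-map⁻ : ∀ {A B : Set} {f : A → B} {n v} (is : Vec A n) →
             v Vec.∈ Vec.map f is → ∃ λ i → i Vec.∈ is × v ≡ f i
vec-∈-map⁻ (i ∷ is) (here e)  = i , here refl , e
vec-∈-map⁻ (i ∷ is) (there p) with vec-∈-map⁻ is p
... | j , j∈is , e = j , there j∈is , e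

map-cong-∈ : ∀ {A B : Set} {f g : A → B} X → (∀ {i} → i ∈ X → f i ≡ g i) → map f X ≡ map g X
map-cong-∈ X e = map-cong-local (All.tabulate e)

sub-cong : (φ : Formula L D) {σ τ : ℕ → Ind D} →
           (∀ {x} → x ∈fv φ → σ x ≡ τ x) → φ ⟦ σ ⟧ ≡ φ ⟦ τ ⟧
sub-cong (atom P is)  e = cong (atom P) (vec-map-cong-∈ is λ {i} i∈is → subᵢ-cong i λ { refl → e i∈is })
sub-cong ⊥ᶠ           e = refl
sub-cong (φ ⇒ ψ)      e = cong₂ _⇒_ (sub-cong φ (e ∘ inj₁)) (sub-cong ψ (e ∘ inj₂))
sub-cong (∀[ z ] φ)   {σ} {τ} e =
  cong (∀[ z ]_) (sub-cong φ λ x∈φ → update-cong σ τ λ x≢z → e (x≢z , x∈φ))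
sub-cong (t ∶[ X ] φ) {σ} {τ} e =
  cong₂ (t ∶[_]_) (map-cong-∈ X λ {i} i∈X → subᵢ-cong i λ { refl → e i∈X })
                  (sub-cong φ λ _ → restrict-cong σ τ X e)

sub-var : (φ : Formula L D) → φ ⟦ var ⟧ ≡ φ
sub-var (atom P is)  = cong (atom P) (trans (Vec.map-cong subᵢ-var is) (Vec.map-id is))
sub-var ⊥ᶠ           = refl
sub-var (φ ⇒ ψ)      = cong₂ _⇒_ (sub-var φ) (sub-var ψ)
sub-var (∀[ z ] φ)   =
  cong (∀[ z ]_) (trans (sub-cong φ λ {x} _ → update-var z x) (sub-var φ))
sub-var (t ∶[ X ] φ) =
  cong₂ (t ∶[_]_) (map-id-local (All.tabulate λ {i} _ → subᵢ-var i))
                  (trans (sub-cong φ λ {x} _ → restrict-var X x) (sub-var φ))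

sub-id : (φ : Formula L D) {σ : ℕ → Ind D} → (∀ {x} → x ∈fv φ → σ x ≡ var x) → φ ⟦ σ ⟧ ≡ φ
sub-id φ e = trans (sub-cong φ e) (sub-var φ)

sub-∉fv : (φ : Formula L D) → x ∉fv φ → φ ⟦ x ≔ i ⟧ ≡ φ
sub-∉fv φ x∉φ = sub-id φ λ {y} y∈φ → update-≢ var λ { refl → x∉φ y∈φ }

sub-∀-≡ : ∀ x (φ : Formula L D) → (∀[ x ] φ) ⟦ x ≔ i ⟧ ≡ ∀[ x ] φ
sub-∀-≡ x φ = sub-∉fv (∀[ x ] φ) λ { (x≢x , _) → x≢x refl }

sub-∀-≢ : (φ : Formula L D) → z ≢ x → (∀[ z ] φ) ⟦ x ≔ i ⟧ ≡ ∀[ z ] (φ ⟦ x ≔ i ⟧)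
sub-∀-≢ {z = z} {x} {i} φ z≢x = cong (∀[ z ]_) (sub-cong φ λ {y} _ → commute y)
  where
  commute : ∀ y → ((var [ x ↦ i ]) [ z ↦ var z ]) y ≡ (var [ x ↦ i ]) y
  commute y with y ≟ z
  ... | yes refl = trans (update-≡ (var [ x ↦ i ]) z) (sym (update-≢ var z≢x))
  ... | no y≢z   = update-≢ (var [ x ↦ i ]) y≢z

-- The only variable moved is x, which lies in X, so the restriction to X changes nothing.
sub-∶-∈ : ∀ t (φ : Formula L D) → var x ∈ X →
          (t ∶[ X ] φ) ⟦ x ≔ i ⟧ ≡ t ∶[ map (subᵢ (var [ x ↦ i ])) X ] (φ ⟦ x ≔ i ⟧)
sub-∶-∈ {x = x} {X} {i} t φ x∈X = cong (t ∶[ _ ]_) (sub-cong φ λ {y} _ → commute y)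
  where
  commute : ∀ y → ((var [ x ↦ i ]) ↾ X) y ≡ (var [ x ↦ i ]) y
  commute y with y var∈? X
  ... | yes _   = refl
  ... | no y∉X = sym (update-≢ var λ { refl → y∉X x∈X })

-- Such a substitution never captures.

Grounding : (ℕ → Ind D) → Set
Grounding σ = ∀ x → σ x ≡ var x ⊎ ∃ λ a → σ x ≡ elem a

grounding-update : {σ : ℕ → Ind D} → Grounding σ → ∀ z → Grounding (σ [ z ↦ var z ])
grounding-update {σ = σ} g z x with x ≟ z
... | yes refl = inj₁ (update-≡ σ x)
... | no x≢z   rewrite update-≢ σ {i = var z} x≢z = g x

grounding-restrict : {σ : ℕ → Ind D} → Grounding σ → ∀ X → Grounding (σ ↾ X)
grounding-restrict g X x with x var∈? X
... | yes _ = g x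
... | no _  = inj₁ refl

-- Composition can fail where σ puts in a variable that is captured; a grounding σ puts in elements
-- only.
sub-sub : (φ : Formula L D) {σ τ υ : ℕ → Ind D} → Grounding σ →
          (∀ x → subᵢ τ (σ x) ≡ υ x) → φ ⟦ σ ⟧ ⟦ τ ⟧ ≡ φ ⟦ υ ⟧
subᵢ-subᵢ : ∀ {σ τ υ : ℕ → Ind D} → (∀ x → subᵢ τ (σ x) ≡ υ x) →
            ∀ i → subᵢ τ (subᵢ σ i) ≡ subᵢ υ i
subᵢ-subᵢ e (var x)  = e x
subᵢ-subᵢ e (elem a) = refl
sub-sub (atom P is)  g e =
  cong (atom P) (trans (sym (Vec.map-∘ _ _ is)) (Vec.map-cong (subᵢ-subᵢ e) is))
sub-sub ⊥ᶠ           g e = refl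
sub-sub (φ ⇒ ψ)      g e = cong₂ _⇒_ (sub-sub φ g e) (sub-sub ψ g e)
sub-sub (∀[ z ] φ) {σ} {τ} {υ} g e =
  cong (∀[ z ]_) (sub-sub φ (grounding-update g z) commute)
  where
  commute : ∀ x → subᵢ (τ [ z ↦ var z ]) ((σ [ z ↦ var z ]) x) ≡ (υ [ z ↦ var z ]) x
  commute x with x ≟ z
  ... | yes refl rewrite update-≡ σ z {var z} | update-≡ υ z {var z} = update-≡ τ z
  ... | no x≢z   rewrite update-≢ σ {i = var z} x≢z | update-≢ υ {i = var z} x≢z with g x
  ...   | inj₁ σx       = trans (cong (subᵢ _) σx) (trans (update-≢ τ x≢z)
                            (trans (sym (cong (subᵢ τ) σx)) (e x)))
  ...   | inj₂ (a , σx) = trans (cong (subᵢ _) σx) (trans (sym (cong (subᵢ τ) σx)) (e x))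
sub-sub (t ∶[ X ] φ) {σ} {τ} {υ} g e =
  cong₂ (t ∶[_]_) (trans (sym (map-∘ X)) (map-cong (subᵢ-subᵢ e) X))
                  (sub-sub φ (grounding-restrict g X) commute)
  where
  X′ = map (subᵢ σ) X
  -- A variable of the new index was already in X, so `τ ↾ X′` moves no variable bound by its
  -- absence from X.
  reflect : var x ∈ X′ → var x ∈ X
  reflect x∈X′ with ∈-map⁻ (subᵢ σ) x∈X′
  ... | var y , y∈X , eq with g y
  ...   | inj₁ σy       with refl ← trans eq σy = y∈X
  ...   | inj₂ (a , σy) with () ← trans eq σy
  commute : ∀ x → subᵢ (τ ↾ X′) ((σ ↾ X) x) ≡ (υ ↾ X) x
  commute x with x var∈? X
  ... | no x∉X = restrict-∉ τ (x∉X ∘ reflect)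
  ... | yes x∈X with g x
  ...   | inj₁ σx       = trans (cong (subᵢ _) σx)
                            (trans (restrict-∈ τ (subst (_∈ X′) σx (∈-map⁺ (subᵢ σ) x∈X)))
                            (trans (sym (cong (subᵢ τ) σx)) (e x)))
  ...   | inj₂ (a , σx) = trans (cong (subᵢ _) σx) (trans (sym (cong (subᵢ τ) σx)) (e x))

-- Variables and elements occurring after a substitution

subᵢ≡var : ∀ {σ : ℕ → Ind D} i → var x ≡ subᵢ σ i → ∃ λ w → i ≡ var w × σ w ≡ var x
subᵢ≡var (var w) e = w , refl , sym e

fv-sub : (φ : Formula L D) {σ : ℕ → Ind D} → x ∈fv φ ⟦ σ ⟧ → ∃ λ w → w ∈fv φ × σ w ≡ var x
fv-sub (atom P is) x∈ with vec-∈-map⁻ is x∈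
... | i , i∈is , e with subᵢ≡var i e
...   | w , refl , σw = w , i∈is , σw
fv-sub (φ ⇒ ψ) (inj₁ x∈) with fv-sub φ x∈
... | w , w∈ , σw = w , inj₁ w∈ , σw
fv-sub (φ ⇒ ψ) (inj₂ x∈) with fv-sub ψ x∈
... | w , w∈ , σw = w , inj₂ w∈ , σw
fv-sub (∀[ z ] φ) {σ} (x≢z , x∈) with fv-sub φ x∈
... | w , w∈ , σw with w ≟ z
...   | yes refl with refl ← trans (sym (update-≡ σ z)) σw = contradiction refl x≢z
...   | no w≢z   = w , (w≢z , w∈) , trans (sym (update-≢ σ w≢z)) σw
fv-sub (t ∶[ X ] φ) x∈ with ∈-map⁻ _ x∈
... | i , i∈X , e with subᵢ≡var i e
...   | w , refl , σw = w , i∈X , σw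

closed-sub-elem : (φ : Formula L D) (ρ : ℕ → D) → Closed (φ ⟦ elem ∘ ρ ⟧)
closed-sub-elem φ ρ x x∈ with fv-sub φ x∈
... | _ , _ , ()

subᵢ≡elem : ∀ {σ : ℕ → Ind D} {a} i → elem a ≡ subᵢ σ i →
            i ≡ elem a ⊎ ∃ λ x → i ≡ var x × σ x ≡ elem a
subᵢ≡elem (var x)  e    = inj₂ (x , refl , sym e)
subᵢ≡elem (elem _) refl = inj₁ refl

occurs-sub : (φ : Formula L D) {σ : ℕ → Ind D} {a : D} →
             a occursIn φ ⟦ σ ⟧ → a occursIn φ ⊎ ∃ λ x → σ x ≡ elem a
occurs-sub (atom P is) a∈ with vec-∈-map⁻ is a∈
... | i , i∈is , e with subᵢ≡elem i e
...   | inj₁ refl           = inj₁ i∈is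
...   | inj₂ (x , refl , σx) = inj₂ (x , σx)
occurs-sub (φ ⇒ ψ) (inj₁ a∈) = Sum.map₁ inj₁ (occurs-sub φ a∈)
occurs-sub (φ ⇒ ψ) (inj₂ a∈) = Sum.map₁ inj₂ (occurs-sub ψ a∈)
occurs-sub (∀[ z ] φ) {σ} a∈ with occurs-sub φ a∈
... | inj₁ a∈φ = inj₁ a∈φ
... | inj₂ (x , σx) with x ≟ z
...   | yes refl with () ← trans (sym (update-≡ σ z)) σx
...   | no x≢z   = inj₂ (x , trans (sym (update-≢ σ x≢z)) σx)
occurs-sub (t ∶[ X ] φ) (inj₁ a∈) with ∈-map⁻ _ a∈
... | i , i∈X , e with subᵢ≡elem i e
...   | inj₁ refl           = inj₁ (inj₁ i∈X)
...   | inj₂ (x , refl , σx) = inj₂ (x , σx)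
occurs-sub (t ∶[ X ] φ) (inj₂ a∈) with occurs-sub φ a∈
... | inj₁ a∈φ = inj₁ (inj₂ a∈φ)
... | inj₂ (x , σx) with x var∈? X
...   | yes _ = inj₂ (x , σx)

-- D-formulas have this property; without it, putting a + N for a variable
-- inside t ∶[ X ] φ could capture.

WellIndexed : Formula L D → Set
WellIndexed (atom P is)  = ⊤
WellIndexed ⊥ᶠ           = ⊤
WellIndexed (φ ⇒ ψ)      = WellIndexed φ × WellIndexed ψ
WellIndexed (∀[ z ] φ)   = WellIndexed φ
WellIndexed (t ∶[ X ] φ) = (∀ {a} → a occursIn φ → elem a ∈ X) × WellIndexed φ

-- Inside `t ∶[ X ] φ` only variables in X are replaced, so every element put into φ is put into the
-- index as well.
wellIndexed-sub : (φ : Formula L D) {σ : ℕ → Ind D} → WellIndexed φ → WellIndexed (φ ⟦ σ ⟧)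
wellIndexed-sub (atom P is)  wi        = tt
wellIndexed-sub ⊥ᶠ           wi        = tt
wellIndexed-sub (φ ⇒ ψ)      (wi , wj) = wellIndexed-sub φ wi , wellIndexed-sub ψ wj
wellIndexed-sub (∀[ z ] φ)   wi        = wellIndexed-sub φ wi
wellIndexed-sub (t ∶[ X ] φ) {σ} (wi , wj) = indexed , wellIndexed-sub φ wj
  where
  indexed : ∀ {a} → a occursIn φ ⟦ σ ↾ X ⟧ → elem a ∈ map (subᵢ σ) X
  indexed a∈ with occurs-sub φ a∈
  ... | inj₁ a∈φ = ∈-map⁺ (subᵢ σ) (wi a∈φ)
  ... | inj₂ (x , σx) with x var∈? X
  ...   | yes x∈X = subst (_∈ map (subᵢ σ) X) σx (∈-map⁺ (subᵢ σ) x∈X)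

embedᵢ≢elem : ∀ {a : D} i → elem a ≢ embedᵢ i
embedᵢ≢elem (var x) ()

¬occurs-embed : (φ : Fml L) {a : D} → ¬ a occursIn embed φ
¬occurs-embed (atom P is) a∈ with vec-∈-map⁻ is a∈
... | i , _ , e = embedᵢ≢elem i e
¬occurs-embed (φ ⇒ ψ)     = [ ¬occurs-embed φ , ¬occurs-embed ψ ]′
¬occurs-embed (∀[ z ] φ)  = ¬occurs-embed φ
¬occurs-embed (t ∶[ X ] φ) (inj₁ a∈) with ∈-map⁻ embedᵢ a∈
... | i , _ , e = embedᵢ≢elem i e
¬occurs-embed (t ∶[ X ] φ) (inj₂ a∈) = ¬occurs-embed φ a∈

wellIndexed-embed : (φ : Fml L) → WellIndexed (embed {D = D} φ)
wellIndexed-embed (atom P is)  = tt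
wellIndexed-embed ⊥ᶠ           = tt
wellIndexed-embed (φ ⇒ ψ)      = wellIndexed-embed φ , wellIndexed-embed ψ
wellIndexed-embed (∀[ z ] φ)   = wellIndexed-embed φ
wellIndexed-embed (t ∶[ X ] φ) = (λ a∈ → contradiction a∈ (¬occurs-embed φ)) , wellIndexed-embed φ

-- Invariance under equality of index sets

occurs-≈ : {φ ψ : Formula L D} → φ ≈ ψ → ∀ {a} → a occursIn φ → a occursIn ψ
occurs-≈ (atom P is)  = id
occurs-≈ ⊥ᶠ           = id
occurs-≈ (e ⇒ e′)     = Sum.map (occurs-≈ e) (occurs-≈ e′)
occurs-≈ (all x e)    = occurs-≈ e
occurs-≈ (just t s e) = Sum.map (Equivalence.to s) (occurs-≈ e)

set-sym : ∀ {A : Set} {X Y : List A} → X ∼[ set ] Y → Y ∼[ set ] X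
set-sym s = mk⇔ (Equivalence.from s) (Equivalence.to s)

≈-refl : (φ : Formula L D) → φ ≈ φ
≈-refl (atom P is)  = atom P is
≈-refl ⊥ᶠ           = ⊥ᶠ
≈-refl (φ ⇒ ψ)      = ≈-refl φ ⇒ ≈-refl ψ
≈-refl (∀[ z ] φ)   = all z (≈-refl φ)
≈-refl (t ∶[ X ] φ) = just t (mk⇔ id id) (≈-refl φ)

≈-sym : {φ ψ : Formula L D} → φ ≈ ψ → ψ ≈ φ
≈-sym (atom P is)  = atom P is
≈-sym ⊥ᶠ           = ⊥ᶠ
≈-sym (e ⇒ e′)     = ≈-sym e ⇒ ≈-sym e′
≈-sym (all x e)    = all x (≈-sym e)
≈-sym (just t s e) = just t (set-sym s) (≈-sym e)

wellIndexed-≈ : {φ ψ : Formula L D} → φ ≈ ψ → WellIndexed φ → WellIndexed ψ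
wellIndexed-≈ (atom P is)  wi        = tt
wellIndexed-≈ ⊥ᶠ           wi        = tt
wellIndexed-≈ (e ⇒ e′)     (wi , wj) = wellIndexed-≈ e wi , wellIndexed-≈ e′ wj
wellIndexed-≈ (all x e)    wi        = wellIndexed-≈ e wi
wellIndexed-≈ (just t s e) (wi , wj) =
  (λ a∈ → Equivalence.to s (wi (occurs-≈ (≈-sym e) a∈))) , wellIndexed-≈ e wj

isDFormula⇒wellIndexed : {χ : Formula L D} → IsDFormula χ → WellIndexed χ
isDFormula⇒wellIndexed (φ , σ , e) =
  wellIndexed-≈ (≈-sym e) (wellIndexed-sub (embed φ) (wellIndexed-embed φ))

-- Renaming a free variable to a fresh one and back

-- Stronger than `y ∉fv φ`: y may not be bound either, by a quantifier or by absence from an index.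
-- Occurrences in a term `gen y t` are allowed, as substitution leaves terms alone.
Fresh : ℕ → Formula L D → Set
Fresh y (atom P is)  = ¬ var y Vec.∈ is
Fresh y ⊥ᶠ           = ⊤
Fresh y (φ ⇒ ψ)      = Fresh y φ × Fresh y ψ
Fresh y (∀[ z ] φ)   = y ≢ z × Fresh y φ
Fresh y (t ∶[ X ] φ) = var y ∉ X × Fresh y φ

fresh⇒∉fv : (φ : Formula L D) → Fresh y φ → y ∉fv φ
fresh⇒∉fv (atom P is)  f        = f
fresh⇒∉fv (φ ⇒ ψ)      (f , g)  = [ fresh⇒∉fv φ f , fresh⇒∉fv ψ g ]′
fresh⇒∉fv (∀[ z ] φ)   (_ , f)  = fresh⇒∉fv φ f ∘ proj₂
fresh⇒∉fv (t ∶[ X ] φ) (f , _)  = f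

subᵢ-rename-inverse : (i : Ind D) → var y ≢ i →
  subᵢ (var [ y ↦ var x ]) (subᵢ (var [ x ↦ var y ]) i) ≡ i
subᵢ-rename-inverse (elem a) _ = refl
subᵢ-rename-inverse {y = y} {x} (var z) y≢z with z ≟ x
... | yes refl = trans (cong (subᵢ _) (update-≡ var z)) (update-≡ var y)
... | no z≢x   = trans (cong (subᵢ _) (update-≢ var z≢x)) (update-≢ var λ { refl → y≢z refl })

-- Every y in the renamed formula stands where x was free, so the second substitution undoes the
-- first. Where x is not free, neither substitution acts.
rename-inverse : (φ : Formula L D) → Fresh y φ → φ ⟦ x ≔ var y ⟧ ⟦ y ≔ var x ⟧ ≡ φ
rename-inverse-∉ : (φ : Formula L D) → Fresh y φ → x ∉fv φ → φ ⟦ x ≔ var y ⟧ ⟦ y ≔ var x ⟧ ≡ φ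
rename-inverse-∉ {y = y} {x} φ f x∉φ =
  trans (cong (_⟦ y ≔ var x ⟧) (sub-∉fv φ x∉φ)) (sub-∉fv φ (fresh⇒∉fv φ f))
rename-inverse {y = y} {x} (atom P is) f = cong (atom P) (begin
  Vec.map _ (Vec.map _ is)  ≡⟨ Vec.map-∘ _ _ is ⟨
  Vec.map _ is              ≡⟨ vec-map-cong-∈ is (λ {i} i∈is → subᵢ-rename-inverse {y = y} {x} i λ { refl → f i∈is }) ⟩
  Vec.map id is             ≡⟨ Vec.map-id is ⟩
  is                        ∎)
  where open ≡-Reasoning
rename-inverse ⊥ᶠ          f       = refl
rename-inverse (φ ⇒ ψ)     (f , g) = cong₂ _⇒_ (rename-inverse φ f) (rename-inverse ψ g)
rename-inverse {y = y} {x} (∀[ z ] φ) (y≢z , f) with z ≟ x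
... | yes refl = rename-inverse-∉ (∀[ z ] φ) (y≢z , f) λ { (z≢z , _) → z≢z refl }
... | no z≢x   = trans (cong (_⟦ y ≔ var x ⟧) (sub-∀-≢ φ z≢x))
                   (trans (sub-∀-≢ _ (y≢z ∘ sym)) (cong (∀[ z ]_) (rename-inverse φ f)))
rename-inverse {y = y} {x} (t ∶[ X ] φ) (y∉X , f) with x var∈? X
... | no x∉X  = rename-inverse-∉ (t ∶[ X ] φ) (y∉X , f) x∉X
... | yes x∈X = trans (cong (_⟦ y ≔ var x ⟧) (sub-∶-∈ t φ x∈X))
                  (trans (sub-∶-∈ t _ y∈X′) (cong₂ (t ∶[_]_) index (rename-inverse φ f)))
  where
  y∈X′ : var y ∈ map (subᵢ (var [ x ↦ var y ])) X
  y∈X′ = subst (_∈ map (subᵢ (var [ x ↦ var y ])) X) (update-≡ var x) (∈-map⁺ (subᵢ (var [ x ↦ var y ])) x∈X)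
  index : map (subᵢ (var [ y ↦ var x ])) (map (subᵢ (var [ x ↦ var y ])) X) ≡ X
  index = trans (sym (map-∘ X))
            (map-id-local (All.tabulate λ {i} i∈X → subᵢ-rename-inverse i λ { refl → y∉X i∈X }))

sub-eliminates : (φ : Formula L D) → i ≢ var x → x ∉fv φ ⟦ x ≔ i ⟧
sub-eliminates {x = x} φ i≢x x∈ with fv-sub φ x∈
... | w , _ , e with w ≟ x
...   | yes refl = i≢x (trans (sym (update-≡ var x)) e)
...   | no w≢x with refl ← trans (sym (update-≢ var w≢x)) e = w≢x refl

-- Each y stands where x was free, hence not in the scope of `∀[ x ]`, and the renaming leaves no
-- other free x that could be captured by an index.
rename-freeFor : (φ : Formula L D) → Fresh y φ → FreeFor x y (φ ⟦ x ≔ var y ⟧)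
rename-freeFor (atom P is) f       = tt
rename-freeFor ⊥ᶠ          f       = tt
rename-freeFor (φ ⇒ ψ)     (f , g) = rename-freeFor φ f , rename-freeFor ψ g
rename-freeFor {y = y} {x} (∀[ z ] φ) (y≢z , f) with z ≟ x
... | yes refl = subst (FreeFor x y) (sym (sub-∀-≡ z φ)) λ { (_ , y∈φ) → contradiction y∈φ (fresh⇒∉fv φ f) }
... | no z≢x   = subst (FreeFor x y) (sym (sub-∀-≢ φ z≢x)) λ _ → z≢x ∘ sym , rename-freeFor φ f
rename-freeFor {y = y} {x} (t ∶[ X ] φ) (y∉X , f) with x var∈? X
... | no x∉X  = subst (FreeFor x y) (sym (sub-∉fv (t ∶[ X ] φ) x∉X)) λ y∈X → contradiction y∈X y∉X
... | yes x∈X = subst (FreeFor x y) (sym (sub-∶-∈ t φ x∈X)) λ _ →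
                  (λ x∈φ → contradiction x∈φ (sub-eliminates φ λ { refl → y∉X x∈X })) ,
                  rename-freeFor φ f

-- Elements as variables: a becomes the variable a + N, which is fresh once N
-- is large.

parᵢ : ℕ → Ind ℕ → Ind ⊥
parᵢ N (var x)  = var x
parᵢ N (elem a) = var (a + N)

par : ℕ → Formula L ℕ → Fml L
par N (atom P is)  = atom P (Vec.map (parᵢ N) is)
par N ⊥ᶠ           = ⊥ᶠ
par N (φ ⇒ ψ)      = par N φ ⇒ par N ψ
par N (∀[ z ] φ)   = ∀[ z ] par N φ
par N (t ∶[ X ] φ) = t ∶[ map (parᵢ N) X ] par N φ

Belowᵢ : ℕ → Ind ℕ → Set
Belowᵢ N (var x)  = x < N
Belowᵢ N (elem a) = a < N

-- The bound on variables, bound ones included, keeps every a + N apart from them; the bound on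
-- elements makes it possible to pick elements that do not occur.
Below : ℕ → Formula L ℕ → Set
Below N (atom P is)  = ∀ i → i Vec.∈ is → Belowᵢ N i
Below N ⊥ᶠ           = ⊤
Below N (φ ⇒ ψ)      = Below N φ × Below N ψ
Below N (∀[ z ] φ)   = z < N × Below N φ
Below N (t ∶[ X ] φ) = (∀ i → i ∈ X → Belowᵢ N i) × Below N φ

-- Conditions that hold for all large N

Eventually : (ℕ → Set) → Set
Eventually P = ∃ λ N₀ → ∀ {N} → N₀ ≤ N → P N

eventually-pure : {P : ℕ → Set} → (∀ {N} → P N) → Eventually P
eventually-pure p = 0 , λ _ → p

eventually-map : {P Q : ℕ → Set} → (∀ {N} → P N → Q N) → Eventually P → Eventually Q
eventually-map f (N₀ , p) = N₀ , f ∘ p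

eventually-× : {P Q : ℕ → Set} → Eventually P → Eventually Q → Eventually (λ N → P N × Q N)
eventually-× (M , p) (N , q) = M ⊔ N , λ le →
  p (≤-trans (m≤m⊔n M N) le) , q (≤-trans (m≤n⊔m M N) le)

eventually-> : ∀ x → Eventually (x <_)
eventually-> x = suc x , id

belowᵢ-eventually : ∀ i → Eventually λ N → Belowᵢ N i
belowᵢ-eventually (var x)  = eventually-> x
belowᵢ-eventually (elem a) = eventually-> a

belowᴸ-eventually : ∀ X → Eventually λ N → ∀ i → i ∈ X → Belowᵢ N i
belowᴸ-eventually []      = eventually-pure λ _ ()
belowᴸ-eventually (i ∷ X) =
  eventually-map (λ { (p , q) _ (here refl) → p ; (p , q) j (there j∈X) → q j j∈X })
    (eventually-× (belowᵢ-eventually i) (belowᴸ-eventually X))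

belowⱽ-eventually : ∀ {n} (is : Vec (Ind ℕ) n) → Eventually λ N → ∀ i → i Vec.∈ is → Belowᵢ N i
belowⱽ-eventually []       = eventually-pure λ _ ()
belowⱽ-eventually (i ∷ is) =
  eventually-map (λ { (p , q) _ (here refl) → p ; (p , q) j (there j∈is) → q j j∈is })
    (eventually-× (belowᵢ-eventually i) (belowⱽ-eventually is))

below-eventually : (φ : Formula L ℕ) → Eventually λ N → Below N φ
below-eventually (atom P is)  = belowⱽ-eventually is
below-eventually ⊥ᶠ           = eventually-pure tt
below-eventually (φ ⇒ ψ)      = eventually-× (below-eventually φ) (below-eventually ψ)
below-eventually (∀[ z ] φ)   = eventually-× (eventually-> z) (below-eventually φ)
below-eventually (t ∶[ X ] φ) = eventually-× (belowᴸ-eventually X) (below-eventually φ)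

occurs-below : (φ : Formula L ℕ) → Below N φ → a occursIn φ → a < N
occurs-below (atom P is)  b       a∈        = b _ a∈
occurs-below (φ ⇒ ψ)      (b , _) (inj₁ a∈) = occurs-below φ b a∈
occurs-below (φ ⇒ ψ)      (_ , b) (inj₂ a∈) = occurs-below ψ b a∈
occurs-below (∀[ z ] φ)   (_ , b) a∈        = occurs-below φ b a∈
occurs-below (t ∶[ X ] φ) (b , _) (inj₁ a∈) = b _ a∈
occurs-below (t ∶[ X ] φ) (_ , b) (inj₂ a∈) = occurs-below φ b a∈

fv-below : (φ : Formula L ℕ) → Below N φ → x ∈fv φ → x < N
fv-below (atom P is)  b       x∈        = b _ x∈
fv-below (φ ⇒ ψ)      (b , _) (inj₁ x∈) = fv-below φ b x∈
fv-below (φ ⇒ ψ)      (_ , b) (inj₂ x∈) = fv-below ψ b x∈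
fv-below (∀[ z ] φ)   (_ , b) (_ , x∈)  = fv-below φ b x∈
fv-below (t ∶[ X ] φ) (b , _) x∈        = b _ x∈

a+N≢x : x < N → a + N ≢ x
a+N≢x {N = N} {a} x<N refl = <-irrefl refl (<-≤-trans x<N (m≤n+m N a))

var-injective : var {D} x ≡ var y → x ≡ y
var-injective refl = refl

parᵢ≡var : ∀ i → x < N → var x ≡ parᵢ N i → i ≡ var x
parᵢ≡var (var x)  _   refl = refl
parᵢ≡var (elem a) x<N refl = contradiction refl (a+N≢x {a = a} x<N)

parᵢ≡elem : ∀ i → Belowᵢ N i → var (a + N) ≡ parᵢ N i → i ≡ elem a
parᵢ≡elem {a = a} (var x)  x<N refl = contradiction refl (a+N≢x {a = a} x<N)
parᵢ≡elem {N} {a} (elem b) _   e    with refl ← +-cancelʳ-≡ N a b (var-injective e) = refl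

var∈par : ∀ X → x < N → var x ∈ map (parᵢ N) X → var x ∈ X
var∈par X x<N x∈ with ∈-map⁻ _ x∈
... | i , i∈X , e with refl ← parᵢ≡var i x<N e = i∈X

elem∈par : ∀ X → (∀ i → i ∈ X → Belowᵢ N i) → var (a + N) ∈ map (parᵢ N) X → elem a ∈ X
elem∈par X b a∈ with ∈-map⁻ _ a∈
... | i , i∈X , e with refl ← parᵢ≡elem i (b i i∈X) e = i∈X

fv-par-var : (φ : Formula L ℕ) → x < N → x ∈fv par N φ → x ∈fv φ
fv-par-var (atom P is) x<N x∈ with vec-∈-map⁻ is x∈
... | i , i∈is , e with refl ← parᵢ≡var i x<N e = i∈is
fv-par-var (φ ⇒ ψ)      x<N = Sum.map (fv-par-var φ x<N) (fv-par-var ψ x<N)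
fv-par-var (∀[ z ] φ)   x<N (x≢z , x∈) = x≢z , fv-par-var φ x<N x∈
fv-par-var (t ∶[ X ] φ) x<N = var∈par X x<N

fv-par-elem : (φ : Formula L ℕ) → Below N φ → a + N ∈fv par N φ → a occursIn φ
fv-par-elem (atom P is) b a∈ with vec-∈-map⁻ is a∈
... | i , i∈is , e with refl ← parᵢ≡elem i (b i i∈is) e = i∈is
fv-par-elem (φ ⇒ ψ)      (b , c) = Sum.map (fv-par-elem φ b) (fv-par-elem ψ c)
fv-par-elem (∀[ z ] φ)   (_ , b) (_ , a∈) = fv-par-elem φ b a∈
fv-par-elem (t ∶[ X ] φ) (b , _) a∈ = inj₁ (elem∈par X b a∈)

fresh-par : (φ : Formula L ℕ) → Below N φ → ¬ a occursIn φ → Fresh (a + N) (par N φ)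
fresh-par {L = L} (atom P is) b a∉ = a∉ ∘ fv-par-elem {L = L} (atom P is) b
fresh-par ⊥ᶠ           b       a∉ = tt
fresh-par (φ ⇒ ψ)      (b , c) a∉ = fresh-par φ b (a∉ ∘ inj₁) , fresh-par ψ c (a∉ ∘ inj₂)
fresh-par {a = a} (∀[ z ] φ) (z<N , b) a∉ = a+N≢x {a = a} z<N , fresh-par φ b a∉
fresh-par (t ∶[ X ] φ) (b , c) a∉ = a∉ ∘ inj₁ ∘ elem∈par X b , fresh-par φ c (a∉ ∘ inj₂)

-- Quantified variables are below N, so none of them captures a + N. If a + N is free in the body of
-- `t ∶[ X ] φ`, then a occurs there, and well-indexedness puts it into X.
freeFor-par : (φ : Formula L ℕ) → WellIndexed φ → Below N φ → FreeFor (a + N) x (par N φ)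
freeFor-par (atom P is)  wi        b         = tt
freeFor-par ⊥ᶠ           wi        b         = tt
freeFor-par (φ ⇒ ψ)      (wi , wj) (b , c)   = freeFor-par φ wi b , freeFor-par ψ wj c
freeFor-par {a = a} (∀[ z ] φ) wi (z<N , b)  = λ _ → a+N≢x {a = a} z<N , freeFor-par φ wi b
freeFor-par {N = N} (t ∶[ X ] φ) (wi , wj) (_ , b) = λ _ →
  (λ a∈ → ∈-map⁺ (parᵢ N) (wi (fv-par-elem φ b a∈))) , freeFor-par φ wj b

parᵢ-sub : x < N → ∀ i j →
  parᵢ N (subᵢ (var [ x ↦ i ]) j) ≡ subᵢ (var [ x ↦ parᵢ N i ]) (parᵢ N j)
parᵢ-sub x<N i (elem a) = sym (update-≢ var (a+N≢x {a = a} x<N))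
parᵢ-sub {x} {N} x<N i (var z) with z ≟ x
... | yes refl = trans (cong (parᵢ N) (update-≡ var z)) (sym (update-≡ var z))
... | no z≢x   = trans (cong (parᵢ N) (update-≢ var z≢x)) (sym (update-≢ var z≢x))

-- Since x < N, no variable that stands for an element is x, so the right-hand substitution hits
-- only the original occurrences of x.
par-sub : x < N → ∀ i (φ : Formula L ℕ) → par N (φ ⟦ x ≔ i ⟧) ≡ par N φ ⟦ x ≔ parᵢ N i ⟧
par-sub x<N i (atom P is) = cong (atom P)
  (trans (sym (Vec.map-∘ _ _ is)) (trans (Vec.map-cong (parᵢ-sub x<N i) is) (Vec.map-∘ _ _ is)))
par-sub x<N i ⊥ᶠ          = refl
par-sub x<N i (φ ⇒ ψ)     = cong₂ _⇒_ (par-sub x<N i φ) (par-sub x<N i ψ)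
par-sub {x} {N} x<N i (∀[ z ] φ) with z ≟ x
... | yes refl = trans (cong (par N) (sub-∀-≡ z φ)) (sym (sub-∀-≡ z (par N φ)))
... | no z≢x   = trans (cong (par N) (sub-∀-≢ φ z≢x))
                   (trans (cong (∀[ z ]_) (par-sub x<N i φ)) (sym (sub-∀-≢ (par N φ) z≢x)))
par-sub {x} {N} x<N i (t ∶[ X ] φ) with x var∈? X
... | no x∉X  = trans (cong (par N) (sub-∉fv (t ∶[ X ] φ) x∉X))
                  (sym (sub-∉fv (par N (t ∶[ X ] φ)) (x∉X ∘ var∈par X x<N)))
... | yes x∈X = trans (cong (par N) (sub-∶-∈ t φ x∈X))
                  (trans (cong₂ (t ∶[_]_) index (par-sub x<N i φ))
                         (sym (sub-∶-∈ t (par N φ) (∈-map⁺ (parᵢ N) x∈X))))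
  where
  index : map (parᵢ N) (map (subᵢ (var [ x ↦ i ])) X) ≡
          map (subᵢ (var [ x ↦ parᵢ N i ])) (map (parᵢ N) X)
  index = trans (sym (map-∘ X)) (trans (map-cong (parᵢ-sub x<N i) X) (map-∘ X))

parᵢ-embedᵢ : ∀ N i → parᵢ N (embedᵢ i) ≡ i
parᵢ-embedᵢ N (var x) = refl

par-embed : ∀ N (φ : Fml L) → par N (embed φ) ≡ φ
par-embed N (atom P is)  = cong (atom P)
  (trans (sym (Vec.map-∘ _ _ is)) (trans (Vec.map-cong (parᵢ-embedᵢ N) is) (Vec.map-id is)))
par-embed N ⊥ᶠ           = refl
par-embed N (φ ⇒ ψ)      = cong₂ _⇒_ (par-embed N φ) (par-embed N ψ)
par-embed N (∀[ z ] φ)   = cong (∀[ z ]_) (par-embed N φ)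
par-embed N (t ∶[ X ] φ) = cong₂ (t ∶[_]_)
  (trans (sym (map-∘ X)) (map-id-local (All.tabulate λ {i} _ → parᵢ-embedᵢ N i))) (par-embed N φ)

fv-embed : (φ : Fml L) → x ∈fv embed {D = D} φ → x ∈fv φ
fv-embed (atom P is) x∈ with vec-∈-map⁻ is x∈
... | var _ , i∈is , refl = i∈is
fv-embed (φ ⇒ ψ)      = Sum.map (fv-embed φ) (fv-embed ψ)
fv-embed (∀[ z ] φ)   (x≢z , x∈) = x≢z , fv-embed φ x∈
fv-embed (t ∶[ X ] φ) x∈ with ∈-map⁻ embedᵢ x∈
... | var _ , i∈X , refl = i∈X

map-set : ∀ {A B : Set} (f : A → B) {X Y} → X ∼[ set ] Y → map f X ∼[ set ] map f Y
map-set f s = mk⇔ (⊆-map⁺ f (Equivalence.to s)) (⊆-map⁺ f (Equivalence.from s))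

par-≈ : {χ ψ : Formula L ℕ} → χ ≈ ψ → par N χ ≈ par N ψ
par-≈ (atom P is)  = atom P _
par-≈ ⊥ᶠ           = ⊥ᶠ
par-≈ (e ⇒ e′)     = par-≈ e ⇒ par-≈ e′
par-≈ (all x e)    = all x (par-≈ e)
par-≈ (just t s e) = just t (map-set _ s) (par-≈ e)

-- Derivability of formulas with parameters

module Derivability {L : Signature} (CS : ConstantSpecification L) where

  private variable
    φ θ : Formula L ℕ

  Der : Formula L ℕ → Set
  Der φ = Eventually λ N → CS ⊢ par N φ

  der-ax : (∀ {N} → Axiom (par N φ)) → Der φ
  der-ax α = eventually-pure (ax α)

  der-mp : Der (φ ⇒ θ) → Der φ → Der θ
  der-mp p q = eventually-map (λ { (p , q) → mp p q }) (eventually-× p q)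

  der-K : ∀ φ θ → Der (φ ⇒ θ ⇒ φ)
  der-K φ θ = der-ax (A1-K _ _)

  der-S : ∀ φ θ ξ → Der ((φ ⇒ θ ⇒ ξ) ⇒ (φ ⇒ θ) ⇒ φ ⇒ ξ)
  der-S φ θ ξ = der-ax (A1-S _ _ _)

  -- The usual derivation of φ ⇒ φ from K and S, where `ax-≈` has turned the last φ of one instance
  -- of K into θ.
  der-≈ : φ ≈ θ → Der (φ ⇒ θ)
  der-≈ {φ} {θ} e =
    der-mp (der-mp (der-S φ (φ ⇒ φ) θ) (der-ax (ax-≈ (≈-refl _ ⇒ ≈-refl _ ⇒ par-≈ e) (A1-K _ _))))
           (der-K φ φ)

  der-inst : ∀ x a φ → WellIndexed φ → Der (∀[ x ] φ ⇒ φ ⟦ x ≔ elem a ⟧)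
  der-inst x a φ wi = eventually-map
    (λ { {N} (x<N , b) → subst (λ ξ → CS ⊢ ∀[ x ] par N φ ⇒ ξ) (sym (par-sub x<N (elem a) φ))
                           (ax (A1-inst x (a + N) (par N φ) (freeFor-par φ wi b))) })
    (eventually-× (eventually-> x) (below-eventually φ))

  der-dist : ∀ x φ θ → x ∉fv φ → Der (∀[ x ] (φ ⇒ θ) ⇒ φ ⇒ ∀[ x ] θ)
  der-dist x φ θ x∉φ =
    eventually-map (λ x<N → ax (A1-dist x _ _ (x∉φ ∘ fv-par-var φ x<N))) (eventually-> x)

  -- Generalise over the variable standing for a, then instantiate with x.

  der-generic : ∀ x a φ → ¬ a occursIn φ → Der (φ ⟦ x ≔ elem a ⟧) → Der φ
  der-generic x a φ a∉φ d = eventually-map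
    (λ { {N} ((x<N , b) , p) →
      let f = fresh-par φ b a∉φ
      in subst (CS ⊢_) (rename-inverse (par N φ) f)
           (mp (ax (A1-inst (a + N) x _ (rename-freeFor (par N φ) f)))
               (gen (a + N) (subst (CS ⊢_) (par-sub x<N (elem a) φ) p))) })
    (eventually-× (eventually-× (eventually-> x) (below-eventually φ)) d)

  parᵢ-∉ : ∀ i X → i ∉ X → Eventually λ N → parᵢ N i ∉ map (parᵢ N) X
  parᵢ-∉ (var x)  X x∉X = eventually-map (λ x<N → x∉X ∘ var∈par X x<N) (eventually-> x)
  parᵢ-∉ (elem a) X a∉X = eventually-map (λ b → a∉X ∘ elem∈par X b) (belowᴸ-eventually X)

  -- The side conditions of A2 hold for the variable a + N once N is large, because it is free in
  -- `par N φ` only if a occurs in φ.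
  der-A2 : ∀ t a X φ → elem a ∉ X → ¬ a occursIn φ → Der (t ∶[ elem a ∷ X ] φ ⇒ t ∶[ X ] φ)
  der-A2 t a X φ a∉X a∉φ = eventually-map
    (λ { (a∉X , b) → ax (A2 t _ _ _ a∉X (a∉φ ∘ fv-par-elem φ b)) })
    (eventually-× (parᵢ-∉ (elem a) X a∉X) (below-eventually φ))

  der-A3 : ∀ t i X φ → i ∉ X → Der (t ∶[ X ] φ ⇒ t ∶[ i ∷ X ] φ)
  der-A3 t (var x)  X φ i∉X = eventually-map (ax ∘ A3 t _ _ _) (parᵢ-∉ (var x) X i∉X)
  der-A3 t (elem a) X φ i∉X = eventually-map (ax ∘ A3 t _ _ _) (parᵢ-∉ (elem a) X i∉X)

  der-B5 : ∀ t X x φ → var x ∉ X → Der (t ∶[ X ] φ ⇒ gen x t ∶[ X ] (∀[ x ] φ))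
  der-B5 t X x φ x∉X = eventually-map (ax ∘ B5 t _ x _) (parᵢ-∉ (var x) X x∉X)

  der-Bb : ∀ t X y φ → var y ∉ X → Der (∀[ y ] (t ∶[ var y ∷ X ] φ) ⇒ 𝖻 t ∶[ X ] (∀[ y ] φ))
  der-Bb t X y φ y∉X = eventually-map (ax ∘ Bb t _ y _) (parᵢ-∉ (var y) X y∉X)

  -- Derivation from finitely many hypotheses

  infixr 5 _⇛_

  -- The newest hypothesis is the innermost premise, so the deduction theorem holds by definition:
  -- `γ ∷ Γ ⊩ φ` is `Γ ⊩ γ ⇒ φ`.
  _⇛_ : List (Formula L ℕ) → Formula L ℕ → Formula L ℕ
  []      ⇛ φ = φ
  (γ ∷ Γ) ⇛ φ = Γ ⇛ (γ ⇒ φ)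

  infix 3 _⊩_

  _⊩_ : List (Formula L ℕ) → Formula L ℕ → Set
  Γ ⊩ φ = Der (Γ ⇛ φ)

  ⊩-der : ∀ Γ → Der φ → Γ ⊩ φ
  ⊩-der []      d = d
  ⊩-der (γ ∷ Γ) d = ⊩-der Γ (der-mp (der-K _ γ) d)

  ⊩-mp : ∀ Γ → Γ ⊩ φ ⇒ θ → Γ ⊩ φ → Γ ⊩ θ
  ⊩-mp []      p q = der-mp p q
  ⊩-mp (γ ∷ Γ) p q = ⊩-mp Γ (⊩-mp Γ (⊩-der Γ (der-S γ _ _)) p) q

  ⊩-weaken : ∀ γ Γ → Γ ⊩ φ → γ ∷ Γ ⊩ φ
  ⊩-weaken γ Γ = ⊩-mp Γ (⊩-der Γ (der-K _ γ))

  ⊩-hyp : ∀ γ Γ → γ ∷ Γ ⊩ γ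
  ⊩-hyp γ Γ = ⊩-der Γ (der-≈ (≈-refl γ))

  ⊩-DN : ∀ Γ → Γ ⊩ (φ ⇒ ⊥ᶠ) ⇒ ⊥ᶠ → Γ ⊩ φ
  ⊩-DN Γ = ⊩-mp Γ (⊩-der Γ (der-ax (A1-DN _)))

  -- Closed hypotheses satisfy the side condition of `A1-dist`, which moves the quantifier past them
  -- one at a time.
  ⊩-gen : ∀ Γ → All Closed Γ → ∀ x → Γ ⊩ φ → Γ ⊩ ∀[ x ] φ
  ⊩-gen []      []       x d = eventually-map (gen x) d
  ⊩-gen (γ ∷ Γ) (c ∷ clΓ) x d = ⊩-mp Γ (⊩-der Γ (der-dist x γ _ (c x))) (⊩-gen Γ clΓ x d)

  ⇛-sub : ∀ Γ → All Closed Γ → ∀ x i φ → (Γ ⇛ φ) ⟦ x ≔ i ⟧ ≡ Γ ⇛ φ ⟦ x ≔ i ⟧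
  ⇛-sub []      []       x i φ = refl
  ⇛-sub (γ ∷ Γ) (c ∷ clΓ) x i φ =
    trans (⇛-sub Γ clΓ x i (γ ⇒ φ)) (cong (λ ξ → Γ ⇛ (ξ ⇒ φ ⟦ x ≔ i ⟧)) (sub-∉fv γ (c x)))

  ¬occurs-⇛ : ∀ Γ φ → All (λ γ → ¬ a occursIn γ) Γ → ¬ a occursIn φ → ¬ a occursIn (Γ ⇛ φ)
  ¬occurs-⇛ []      φ []       a∉φ = a∉φ
  ¬occurs-⇛ (γ ∷ Γ) φ (n ∷ ns) a∉φ = ¬occurs-⇛ Γ (γ ⇒ φ) ns [ n , a∉φ ]′

  -- Substitution leaves closed hypotheses alone, so the assumption is an instance of the whole
  -- implication `Γ ⇛ φ`, in which a does not occur.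
  ⊩-generic : ∀ Γ → All Closed Γ → All (λ γ → ¬ a occursIn γ) Γ → ∀ x φ → ¬ a occursIn φ →
              Γ ⊩ φ ⟦ x ≔ elem a ⟧ → Γ ⊩ φ
  ⊩-generic {a} Γ clΓ ns x φ a∉φ d =
    der-generic x a (Γ ⇛ φ) (¬occurs-⇛ Γ φ ns a∉φ) (subst Der (sym (⇛-sub Γ clΓ x (elem a) φ)) d)

-- Coding formulas by natural numbers

-- An intermediate format: syntax is tagged in trees, and the arithmetic of pairing is done once,
-- for trees.
data Tree : Set where
  leaf : ℕ → Tree
  node : Tree → Tree → Tree

-- This is the number 2^m (2n + 1).
pair : ℕ → ℕ → ℕ
pair zero    n = suc (n + n)
pair (suc m) n = pair m n + pair m n

double-injective : ∀ m n → m + m ≡ n + n → m ≡ n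
double-injective zero    zero    e = refl
double-injective (suc m) (suc n) e
  rewrite +-suc m m | +-suc n n = cong suc (double-injective m n (suc-injective (suc-injective e)))

odd≢even : ∀ m n → suc (m + m) ≢ n + n
odd≢even m (suc n) e rewrite +-suc n n = odd≢even n m (sym (suc-injective e))

pair-injective : ∀ m n k l → pair m k ≡ pair n l → m ≡ n × k ≡ l
pair-injective zero    zero    k l e = refl , double-injective k l (suc-injective e)
pair-injective zero    (suc n) k l e = contradiction e (odd≢even k (pair n l))
pair-injective (suc m) zero    k l e = contradiction (sym e) (odd≢even l (pair m k))
pair-injective (suc m) (suc n) k l e with pair-injective m n k l (double-injective (pair m k) (pair n l) e)
... | refl , refl = refl , refl

-- First component 0 marks a leaf; the successor keeps nodes apart from leaves.
codeᵗ : Tree → ℕ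
codeᵗ (leaf n)   = pair 0 n
codeᵗ (node t u) = pair (suc (codeᵗ t)) (codeᵗ u)

codeᵗ-injective : ∀ t u → codeᵗ t ≡ codeᵗ u → t ≡ u
codeᵗ-injective (leaf m)   (leaf n)     e = cong leaf (proj₂ (pair-injective 0 0 m n e))
codeᵗ-injective (leaf m)   (node u u′)  e with () ← proj₁ (pair-injective 0 (suc (codeᵗ u)) m (codeᵗ u′) e)
codeᵗ-injective (node t t′) (leaf n)    e with () ← proj₁ (pair-injective (suc (codeᵗ t)) 0 (codeᵗ t′) n e)
codeᵗ-injective (node t t′) (node u u′) e with pair-injective (suc (codeᵗ t)) (suc (codeᵗ u)) (codeᵗ t′) (codeᵗ u′) e
... | e₁ , e₂ = cong₂ node (codeᵗ-injective t u (suc-injective e₁)) (codeᵗ-injective t′ u′ e₂)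

node-injective : ∀ {t t′ u u′} → node t t′ ≡ node u u′ → t ≡ u × t′ ≡ u′
node-injective refl = refl , refl

leaf-injective : ∀ {m n} → leaf m ≡ leaf n → m ≡ n
leaf-injective refl = refl

term-tree : Term → Tree
term-tree (pvar n)  = node (leaf 0) (leaf n)
term-tree (con n)   = node (leaf 1) (leaf n)
term-tree (t · s)   = node (leaf 2) (node (term-tree t) (term-tree s))
term-tree (t ∔ s)   = node (leaf 3) (node (term-tree t) (term-tree s))
term-tree (! t)     = node (leaf 4) (term-tree t)
term-tree (𝖻 t)     = node (leaf 5) (term-tree t)
term-tree (gen x t) = node (leaf 6) (node (leaf x) (term-tree t))

term-tree-injective : ∀ t s → term-tree t ≡ term-tree s → t ≡ s
term-tree-injective (pvar n)  (pvar _)   refl = refl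
term-tree-injective (con n)   (con _)    refl = refl
term-tree-injective (t · u)   (s · v)    e with node-injective (proj₂ (node-injective e))
... | e₁ , e₂ = cong₂ _·_ (term-tree-injective t s e₁) (term-tree-injective u v e₂)
term-tree-injective (t ∔ u)   (s ∔ v)    e with node-injective (proj₂ (node-injective e))
... | e₁ , e₂ = cong₂ _∔_ (term-tree-injective t s e₁) (term-tree-injective u v e₂)
term-tree-injective (! t)     (! s)      e = cong !_ (term-tree-injective t s (proj₂ (node-injective e)))
term-tree-injective (𝖻 t)     (𝖻 s)      e = cong 𝖻 (term-tree-injective t s (proj₂ (node-injective e)))
term-tree-injective (gen x t) (gen y s)  e with node-injective (proj₂ (node-injective e))
... | e₁ , e₂ = cong₂ gen (leaf-injective e₁) (term-tree-injective t s e₂)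

ind-tree : Ind ℕ → Tree
ind-tree (var x)  = node (leaf 0) (leaf x)
ind-tree (elem a) = node (leaf 1) (leaf a)

ind-tree-injective : ∀ i j → ind-tree i ≡ ind-tree j → i ≡ j
ind-tree-injective (var x)  (var _)  refl = refl
ind-tree-injective (elem a) (elem _) refl = refl

index-tree : List (Ind ℕ) → Tree
index-tree []      = leaf 0
index-tree (i ∷ X) = node (ind-tree i) (index-tree X)

index-tree-injective : ∀ X Y → index-tree X ≡ index-tree Y → X ≡ Y
index-tree-injective []      []      e = refl
index-tree-injective (i ∷ X) (j ∷ Y) e with node-injective e
... | e₁ , e₂ = cong₂ _∷_ (ind-tree-injective i j e₁) (index-tree-injective X Y e₂)

module _ {L : Signature} where
  open Injection (countable L) using () renaming (to to symbol; injective to symbol-injective)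

  formula-tree : Formula L ℕ → Tree
  formula-tree (atom P is)  = node (leaf 0) (node (leaf (symbol P)) (index-tree (Vec.toList is)))
  formula-tree ⊥ᶠ           = leaf 0
  formula-tree (φ ⇒ ψ)      = node (leaf 1) (node (formula-tree φ) (formula-tree ψ))
  formula-tree (∀[ x ] φ)   = node (leaf 2) (node (leaf x) (formula-tree φ))
  formula-tree (t ∶[ X ] φ) =
    node (leaf 3) (node (term-tree t) (node (index-tree X) (formula-tree φ)))

  formula-tree-injective : ∀ φ ψ → formula-tree φ ≡ formula-tree ψ → φ ≡ ψ
  formula-tree-injective (atom P is) (atom Q js) e with node-injective (proj₂ (node-injective e))
  ... | e₁ , e₂ with symbol-injective (leaf-injective e₁)
  ...   | refl = cong (atom P) (trans (sym (Vec.cast-is-id refl is))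
                   (Vec.toList-injective refl is js (index-tree-injective _ _ e₂)))
  formula-tree-injective ⊥ᶠ ⊥ᶠ e = refl
  formula-tree-injective (φ ⇒ φ′) (ψ ⇒ ψ′) e with node-injective (proj₂ (node-injective e))
  ... | e₁ , e₂ = cong₂ _⇒_ (formula-tree-injective φ ψ e₁) (formula-tree-injective φ′ ψ′ e₂)
  formula-tree-injective (∀[ x ] φ) (∀[ y ] ψ) e with node-injective (proj₂ (node-injective e))
  ... | e₁ , e₂ = cong₂ ∀[_]_ (leaf-injective e₁) (formula-tree-injective φ ψ e₂)
  formula-tree-injective (t ∶[ X ] φ) (s ∶[ Y ] ψ) e with node-injective (proj₂ (node-injective e))
  ... | e₁ , e₂₃ with node-injective e₂₃
  ...   | e₂ , e₃ with term-tree-injective t s e₁ | index-tree-injective X Y e₂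
  ...     | refl | refl = cong (t ∶[ X ]_) (formula-tree-injective φ ψ e₃)

  code : Formula L ℕ → ℕ
  code φ = codeᵗ (formula-tree φ)

  code-injective : ∀ φ ψ → code φ ≡ code ψ → φ ≡ ψ
  code-injective φ ψ = formula-tree-injective φ ψ ∘ codeᵗ-injective _ _

-- The Henkin construction

Sentence : ∀ {L} → Formula L ℕ → Set
Sentence φ = Closed φ × WellIndexed φ

closed-inst : ∀ {L x a} (φ : Formula L ℕ) → Closed (∀[ x ] φ) → Closed (φ ⟦ x ≔ elem a ⟧)
closed-inst {x = x} φ c y y∈ with fv-sub φ y∈
... | w , w∈ , e with w ≟ x
...   | yes refl with () ← trans (sym (update-≡ var x)) e
...   | no w≢x   = c w (w≢x , w∈)

module Henkin (em : ExcludedMiddle 0ℓ) {L : Signature} (CS : ConstantSpecification L) where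
  open Derivability CS

  -- A theory with finitely many hypotheses, so that there is always an element that occurs in none
  -- of them.
  record Stage : Set where
    field
      hyps       : List (Formula L ℕ)
      sentences  : All Sentence hyps
      consistent : ¬ (hyps ⊩ ⊥ᶠ)

    closed : All Closed hyps
    closed = All.map proj₁ sentences

  open Stage

  infix 4 _⊑_

  _⊑_ : Stage → Stage → Set
  S ⊑ T = ∀ {φ} → hyps S ⊩ φ → hyps T ⊩ φ

  -- The equation makes the condition vacuous for formulas that are not universal, so all formulas
  -- are treated alike.
  Counterexample : (Formula L ℕ → Set) → Formula L ℕ → Set
  Counterexample T φ = ∀ {x ψ} → φ ≡ ∀[ x ] ψ → ∃ λ a → T (ψ ⟦ x ≔ elem a ⟧ ⇒ ⊥ᶠ)

  Decides : (Formula L ℕ → Set) → Formula L ℕ → Set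
  Decides T φ = T φ ⊎ T (φ ⇒ ⊥ᶠ) × Counterexample T φ

  add-negation : ∀ S φ → Sentence φ → ¬ (hyps S ⊩ φ) → ∃ λ T → S ⊑ T × (hyps T ⊩ φ ⇒ ⊥ᶠ)
  add-negation S φ (c , wi) ¬Sφ = T , ⊩-weaken (φ ⇒ ⊥ᶠ) (hyps S) , ⊩-hyp (φ ⇒ ⊥ᶠ) (hyps S)
    where
    T : Stage
    T = record
      { hyps       = (φ ⇒ ⊥ᶠ) ∷ hyps S
      ; sentences  = ((λ { x (inj₁ x∈φ) → c x x∈φ }) , wi , tt) ∷ sentences S
      -- That the extended list derives ⊥ means by definition that the old one derives the double
      -- negation of φ.
      ; consistent = ¬Sφ ∘ ⊩-DN (hyps S)
      }

  fresh-element : (Γ : List (Formula L ℕ)) → Eventually λ a → All (λ γ → ¬ a occursIn γ) Γ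
  fresh-element []      = eventually-pure []
  fresh-element (γ ∷ Γ) =
    eventually-map (λ { (b , bs) → (<-irrefl refl ∘ occurs-below γ b) ∷ bs })
      (eventually-× (below-eventually γ) (fresh-element Γ))

  -- Choose a fresh a. If ψ(a) were derivable, so would be ψ and then `∀[ x ] ψ`, against its
  -- refutation; hence the negation of ψ(a) can be added consistently.
  add-counterexample : ∀ S φ → Sentence φ → hyps S ⊩ φ ⇒ ⊥ᶠ → ∃ λ T → S ⊑ T × Counterexample (hyps T ⊩_) φ
  add-counterexample S (∀[ x ] ψ) (c , wi) ¬∀ψ with fresh-element (ψ ∷ hyps S)
  -- The element a is the threshold itself.
  ... | a , fresh with fresh ≤-refl
  ...   | a∉ψ ∷ a∉S with add-negation S (ψ ⟦ x ≔ elem a ⟧) (closed-inst ψ c , wellIndexed-sub ψ wi)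
                           (λ ψa → consistent S (⊩-mp (hyps S) ¬∀ψ
                              (⊩-gen (hyps S) (closed S) x (⊩-generic (hyps S) (closed S) a∉S x ψ a∉ψ ψa))))
  ...     | T , S⊑T , ¬ψa = T , S⊑T , λ { refl → a , ¬ψa }
  add-counterexample S (atom P is)  _ _ = S , id , λ ()
  add-counterexample S ⊥ᶠ           _ _ = S , id , λ ()
  add-counterexample S (φ ⇒ ψ)      _ _ = S , id , λ ()
  add-counterexample S (t ∶[ X ] φ) _ _ = S , id , λ ()

  decide : ∀ S φ → Sentence φ → ∃ λ T → S ⊑ T × Decides (hyps T ⊩_) φ
  decide S φ s with em {hyps S ⊩ φ}
  ... | yes Sφ = S , id , inj₁ Sφ
  ... | no ¬Sφ with add-negation S φ s ¬Sφ
  ...   | T , S⊑T , T¬φ with add-counterexample T φ s T¬φ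
  ...     | U , T⊑U , w = U , T⊑U ∘ S⊑T , inj₂ (T⊑U T¬φ , w)

  -- At most one sentence has code n. Excluded middle tells whether there is one, so no decoding
  -- function has to be defined.
  advance : ∀ S n → ∃ λ T → S ⊑ T × (∀ φ → code φ ≡ n → Sentence φ → Decides (hyps T ⊩_) φ)
  advance S n with em {∃ λ φ → code φ ≡ n × Sentence φ}
  ... | no none = S , id , λ φ e s → contradiction (φ , e , s) none
  ... | yes (φ , e , s) with decide S φ s
  ...   | T , S⊑T , d = T , S⊑T , λ ψ e′ _ → subst (Decides (hyps T ⊩_)) (code-injective φ ψ (trans e (sym e′))) d

  -- The completed theory

  module Completion (S₀ : Stage) where

    stage : ℕ → Stage
    stage zero    = S₀
    stage (suc n) = proj₁ (advance (stage n) n)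

    stage-mono : ∀ {m n} → m ≤ n → stage m ⊑ stage n
    stage-mono {m} {n} m≤n with m≤n⇒m<n∨m≡n m≤n
    ... | inj₂ refl = id
    stage-mono {m} {suc n} _ | inj₁ m<n = proj₁ (proj₂ (advance (stage n) n)) ∘ stage-mono (≤-pred m<n)

    Th : Formula L ℕ → Set
    Th φ = ∃ λ n → hyps (stage n) ⊩ φ

    th-der : ∀ {φ} → Der φ → Th φ
    th-der d = 0 , ⊩-der (hyps S₀) d

    th-mp : ∀ {φ ψ} → Th (φ ⇒ ψ) → Th φ → Th ψ
    th-mp (m , p) (n , q) = m ⊔ n ,
      ⊩-mp (hyps (stage (m ⊔ n))) (stage-mono (m≤m⊔n m n) p) (stage-mono (m≤n⊔m m n) q)

    th-app : ∀ {φ ψ} → Der (φ ⇒ ψ) → Th φ → Th ψ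
    th-app = th-mp ∘ th-der

    th-consistent : ¬ Th ⊥ᶠ
    th-consistent (n , p) = consistent (stage n) p

    -- `Th` also contains open formulas; they can be generalized because the hypotheses of each
    -- stage are closed.
    th-gen : ∀ {φ} x → Th φ → Th (∀[ x ] φ)
    th-gen x (n , p) = n , ⊩-gen (hyps (stage n)) (closed (stage n)) x p

    th-decides : ∀ φ → Sentence φ → Decides Th φ
    th-decides φ s = at (code φ) refl
      where
      at : ∀ n → code φ ≡ n → Decides Th φ
      -- The sentence with code n is decided in passing from stage n, thus at stage n + 1.
      at n e with proj₂ (proj₂ (advance (stage n) n)) φ e s
      ... | inj₁ Tφ        = inj₁ (suc n , Tφ)
      ... | inj₂ (T¬φ , w) = inj₂ ((suc n , T¬φ) , λ eq → proj₁ (w eq) , suc n , proj₂ (w eq))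

    -- φ is decided: if it is in the theory, so is ψ and K applies; if it is refuted, the
    -- implication follows by ex falso.
    th-⇒ : ∀ {φ ψ} → Sentence φ → (Th φ → Th ψ) → Th (φ ⇒ ψ)
    th-⇒ {φ} {ψ} s f with th-decides φ s
    ... | inj₁ Tφ        = th-app (der-K ψ φ) (f Tφ)
    ... | inj₂ (T¬φ , _) = th-mp (th-app (der-S φ ⊥ᶠ ψ) (th-der (der-mp (der-K _ φ) der-⊥))) T¬φ
      where
      -- K gives the implication from ⊥ to the double negation of ψ, which is composed with `A1-DN`.
      der-⊥ : Der (⊥ᶠ ⇒ ψ)
      der-⊥ = der-mp (der-mp (der-S ⊥ᶠ ((ψ ⇒ ⊥ᶠ) ⇒ ⊥ᶠ) ψ) (der-mp (der-K _ ⊥ᶠ) (der-ax (A1-DN _))))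
                     (der-K ⊥ᶠ (ψ ⇒ ⊥ᶠ))

    -- The ω-rule: a refuted universal sentence would have a counterexample among the given
    -- instances.
    th-∀ : ∀ x φ → Sentence (∀[ x ] φ) → (∀ a → Th (φ ⟦ x ≔ elem a ⟧)) → Th (∀[ x ] φ)
    th-∀ x φ s f with th-decides (∀[ x ] φ) s
    ... | inj₁ T∀φ     = T∀φ
    ... | inj₂ (_ , w) with w refl
    ...   | a , T¬φa   = contradiction (th-mp T¬φa (f a)) th-consistent

    th-inst : ∀ {φ x} a → WellIndexed φ → Th φ → Th (φ ⟦ x ≔ elem a ⟧)
    th-inst {φ} {x} a wi p = th-app (der-inst x a φ wi) (th-gen x p)

-- The one-world model and its evidence function

module Canonical (em : ExcludedMiddle 0ℓ) {L : Signature} (CS : ConstantSpecification L)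
                 (S₀ : Henkin.Stage em CS) where
  open Derivability CS
  open Henkin em CS
  open Completion S₀

  private variable
    φ ψ : Formula L ℕ
    t : Term

  th-≈ : φ ≈ ψ → Th φ → Th ψ
  th-≈ = th-app ∘ der-≈

  th-same-index : {X Y : List (Ind ℕ)} → X ⊆ Y → Y ⊆ X → Th (t ∶[ X ] φ) → Th (t ∶[ Y ] φ)
  th-same-index {t = t} {φ} X⊆Y Y⊆X = th-≈ (just t (mk⇔ X⊆Y Y⊆X) (≈-refl φ))

  ∈∷⇒⊆ : ∀ {A : Set} {i : A} {X} → i ∈ X → i ∷ X ⊆ X
  ∈∷⇒⊆ i∈X (here refl) = i∈X
  ∈∷⇒⊆ i∈X (there j∈X) = j∈X

  -- A3 adds an entry that is new; an entry already present leaves the index set unchanged.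
  th-prepend : ∀ Y {X} → Th (t ∶[ X ] φ) → Th (t ∶[ Y ++ X ] φ)
  th-prepend []      p = p
  th-prepend (i ∷ Y) {X} p with em {i ∈ Y ++ X}
  ... | yes i∈ = th-same-index there (∈∷⇒⊆ i∈) (th-prepend Y p)
  ... | no i∉  = th-app (der-A3 _ i (Y ++ X) _ i∉) (th-prepend Y p)

  th-weaken : ∀ {X Y} → X ⊆ Y → Th (t ∶[ X ] φ) → Th (t ∶[ Y ] φ)
  th-weaken {X = X} {Y} X⊆Y = th-same-index ([ id , X⊆Y ]′ ∘ ∈-++⁻ Y) ∈-++⁺ˡ ∘ th-prepend Y

  -- Entries of X are dropped one by one: a repeated one does not change the set, and any other lies
  -- outside Y, hence does not occur in φ, so A2 removes it.
  th-strengthen : ∀ X Y → (∀ {a} → a occursIn φ → a ∈ Y) →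
                  Th (t ∶[ map elem (X ++ Y) ] φ) → Th (t ∶[ map elem Y ] φ)
  th-strengthen []      Y φ⊆Y p = p
  th-strengthen (a ∷ X) Y φ⊆Y p with em {elem a ∈ map elem (X ++ Y)}
  ... | yes a∈ = th-strengthen X Y φ⊆Y (th-same-index (∈∷⇒⊆ a∈) there p)
  ... | no a∉  = th-strengthen X Y φ⊆Y
                   (th-app (der-A2 _ a _ _ a∉ (a∉ ∘ ∈-map⁺ elem ∘ ∈-++⁺ʳ X ∘ φ⊆Y)) p)

  -- The passage goes through the union: A3 enlarges X to `X ++ Y`, and A2 shrinks it to Y.
  th-reindex : ∀ X Y → (∀ {a} → a occursIn φ → a ∈ Y) →
               Th (t ∶[ map elem X ] φ) → Th (t ∶[ map elem Y ] φ)
  th-reindex X Y φ⊆Y p = th-strengthen X Y φ⊆Y (th-weaken (⊆-map⁺ elem (xs⊆xs++ys X Y)) p)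

  -- By A2 and A3 the choice of X is immaterial.

  Evidence : Term → Formula L ℕ → Set
  Evidence t φ = ∃ λ X → (∀ {a} → a occursIn φ → a ∈ X) × Th (t ∶[ map elem X ] φ)

  var∉elems : ∀ {x} (X : List ℕ) → var x ∉ map elem X
  var∉elems X x∈ with ∈-map⁻ elem x∈
  ... | _ , _ , ()

  sub-index : ∀ t y a Z (φ : Formula L ℕ) →
    (t ∶[ var y ∷ map elem Z ] φ) ⟦ y ≔ elem a ⟧ ≡ t ∶[ map elem (a ∷ Z) ] (φ ⟦ y ≔ elem a ⟧)
  sub-index t y a Z φ = trans (sub-∶-∈ t φ (here refl))
    (cong (t ∶[_] (φ ⟦ y ≔ elem a ⟧)) (cong₂ _∷_ (update-≡ var y) (sym (map-∘ Z))))

  occurs-inst : ∀ {x a b} (φ : Formula L ℕ) → b occursIn φ ⟦ x ≔ elem a ⟧ → b occursIn φ ⊎ b ≡ a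
  occurs-inst {x} φ b∈ with occurs-sub φ b∈
  ... | inj₁ b∈φ     = inj₁ b∈φ
  ... | inj₂ (z , e) with z ≟ x
  ...   | yes refl with refl ← trans (sym (update-≡ var x)) e = inj₂ refl
  ...   | no z≢x   with () ← trans (sym (update-≢ var z≢x)) e

  -- B2 wants one index for both premises; the union of the two given ones serves.
  evidence-· : ∀ {s} → Evidence t (φ ⇒ ψ) → Evidence s φ → Evidence (t · s) ψ
  evidence-· {t} {φ} {ψ} {s} (X , X⊇ , p) (Y , _ , q) =
    X ++ Y , ∈-++⁺ˡ ∘ X⊇ ∘ inj₂ ,
    th-mp (th-app (der-ax {φ = t ∶[ Z ] (φ ⇒ ψ) ⇒ s ∶[ Z ] φ ⇒ (t · s) ∶[ Z ] ψ} (B2 t s _ _ _))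
             (th-weaken (⊆-map⁺ elem (xs⊆xs++ys X Y)) p))
          (th-weaken (⊆-map⁺ elem (xs⊆ys++xs Y X)) q)
    where Z = map elem (X ++ Y)

  evidence-! : ∀ X → (∀ a → a occursIn φ → a ∈ X) → Evidence t φ → Evidence (! t) (t ∶[ map elem X ] φ)
  evidence-! {φ} {t} X X⊇ (Y , _ , p) = X , covers ,
    th-app (der-ax {φ = t ∶[ map elem X ] φ ⇒ (! t) ∶[ map elem X ] (t ∶[ map elem X ] φ)} (B4 t _ _))
           (th-reindex Y X (X⊇ _) p)
    where
    covers : ∀ {a} → a occursIn (t ∶[ map elem X ] φ) → a ∈ X
    covers (inj₂ a∈φ) = X⊇ _ a∈φ
    covers (inj₁ a∈X) with ∈-map⁻ elem a∈X
    ... | _ , b∈X , refl = b∈X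

  wellIndexed-∷ : ∀ t (φ : Formula L ℕ) {x X} → WellIndexed φ → (∀ {a} → a occursIn φ → a ∈ X) →
                  WellIndexed (t ∶[ var x ∷ map elem X ] φ)
  wellIndexed-∷ t φ wi X⊇ = there ∘ ∈-map⁺ elem ∘ X⊇ , wi

  -- A3 puts x into the index, so that the instantiation reaches it.

  evidence-inst : ∀ x a → WellIndexed φ → Evidence t φ → Evidence t (φ ⟦ x ≔ elem a ⟧)
  evidence-inst {φ} {t} x a wi (X , X⊇ , p) =
    a ∷ X , [ there ∘ X⊇ , here ]′ ∘ occurs-inst φ ,
    subst Th (sub-index t x a X φ) (th-inst a (wellIndexed-∷ t φ wi X⊇) (th-weaken there p))

  -- An index consisting of elements contains no variable, so the side condition of B5 holds.
  evidence-gen : ∀ x → Evidence t φ → Evidence (gen x t) (∀[ x ] φ)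
  evidence-gen {t} {φ} x (X , X⊇ , p) = X , X⊇ , th-app (der-B5 t _ x φ (var∉elems X)) p

  -- Each instance brings its own index. Reindexing to `a ∷ Z` with a fixed Z makes them instances
  -- of one universal sentence, to which the ω-rule and then Bb apply.
  evidence-𝖻 : ∀ y → WellIndexed φ → (∀ a → Evidence t (φ ⟦ y ≔ elem a ⟧)) → Evidence (𝖻 t) (∀[ y ] φ)
  evidence-𝖻 {φ} {t} y wi ev = Z , Z⊇ , th-app (der-Bb t _ y φ (var∉elems Z)) (th-∀ y _ sentence instances)
    where
    bound = below-eventually φ
    -- All numbers below a bound for φ: this covers the elements of φ and is independent of a.
    Z = upTo (proj₁ bound)
    Z⊇ : ∀ {a} → a occursIn φ → a ∈ Z
    Z⊇ = ∈-upTo⁺ ∘ occurs-below φ (proj₂ bound ≤-refl)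
    sentence : Sentence (∀[ y ] (t ∶[ var y ∷ map elem Z ] φ))
    sentence = (λ { x (x≢y , here refl) → x≢y refl ; x (_ , there x∈Z) → var∉elems Z x∈Z })
             , wellIndexed-∷ t φ wi Z⊇
    instances : ∀ a → Th ((t ∶[ var y ∷ map elem Z ] φ) ⟦ y ≔ elem a ⟧)
    instances a with ev a
    ... | X , _ , p = subst Th (sym (sub-index t y a Z φ))
                        (th-reindex X (a ∷ Z) ([ there ∘ Z⊇ , here ]′ ∘ occurs-inst φ) p)

  evidence-con : ∀ {c ψ} → Spec CS c ψ → Evidence (con c) (embed ψ)
  evidence-con {c} {ψ} s = [] , (λ a∈ → contradiction a∈ (¬occurs-embed ψ)) ,
    th-der (eventually-pure λ {N} → subst (λ ξ → CS ⊢ con c ∶[ [] ] ξ) (sym (par-embed N ψ)) (cs s))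

  model : FittingModel L
  model = record
    { W      = ⊤
    ; w₀     = tt
    ; R      = λ _ _ → ⊤
    ; D      = ℕ
    ; d₀     = 0
    ; I      = λ P _ as → Th (atom P (Vec.map elem as))
    ; E      = λ t φ _ → Evidence t φ
    ; E-≈    = λ { {t} _ e (X , X⊇ , p) → X , X⊇ ∘ occurs-≈ (≈-sym e) , th-≈ (just t (mk⇔ id id) e) p }
    ; E-·    = λ _ → evidence-·
    ; E-∔    = λ { {s} {t} {φ} _ (inj₁ (X , X⊇ , p)) →
                     X , X⊇ , th-app (der-ax {φ = s ∶[ map elem X ] φ ⇒ (s ∔ t) ∶[ map elem X ] φ} (B3ˡ s t _ _)) p
                 ; {s} {t} {φ} _ (inj₂ (X , X⊇ , p)) →
                     X , X⊇ , th-app (der-ax {φ = t ∶[ map elem X ] φ ⇒ (s ∔ t) ∶[ map elem X ] φ} (B3ʳ s t _ _)) p }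
    ; E-!    = λ X _ → evidence-! X
    ; E-R    = λ _ _ → id
    ; E-inst = λ x a dφ → evidence-inst x a (isDFormula⇒wellIndexed dφ)
    ; E-gen  = λ x _ → evidence-gen x
    ; E-𝖻    = λ y dφ → evidence-𝖻 y (isDFormula⇒wellIndexed dφ)
    }

  -- Ground instances and the truth lemma

  -- Variables below k get their values and the others stay. Filling one variable at a time reduces
  -- the simultaneous substitution to iterated `th-inst`.
  assign : (ℕ → ℕ) → ℕ → ℕ → Ind ℕ
  assign ρ zero    = var
  assign ρ (suc k) = assign ρ k [ k ↦ elem (ρ k) ]

  assign-≥ : ∀ ρ k {x} → k ≤ x → assign ρ k x ≡ var x
  assign-≥ ρ zero    _   = refl
  assign-≥ ρ (suc k) k<x = trans (update-≢ (assign ρ k) (>⇒≢ k<x)) (assign-≥ ρ k (<⇒≤ k<x))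

  assign-< : ∀ ρ k {x} → x < k → assign ρ k x ≡ elem (ρ x)
  assign-< ρ (suc k) {x} x<1+k with x ≟ k
  ... | yes refl = update-≡ (assign ρ k) k
  ... | no x≢k   = trans (update-≢ (assign ρ k) x≢k) (assign-< ρ k (≤∧≢⇒< (≤-pred x<1+k) x≢k))

  assign-grounding : ∀ ρ k → Grounding (assign ρ k)
  assign-grounding ρ k x with x <? k
  ... | yes x<k = inj₂ (ρ x , assign-< ρ k x<k)
  ... | no x≮k  = inj₁ (assign-≥ ρ k (≮⇒≥ x≮k))

  assign-step : ∀ ρ k x → subᵢ (var [ k ↦ elem (ρ k) ]) (assign ρ k x) ≡ assign ρ (suc k) x
  assign-step ρ k x with x ≟ k
  ... | yes refl = trans (cong (subᵢ _) (assign-≥ ρ k (≤-refl {k})))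
                     (trans (update-≡ var k) (sym (update-≡ (assign ρ k) k)))
  ... | no x≢k   rewrite update-≢ (assign ρ k) {i = elem (ρ k)} x≢k with assign-grounding ρ k x
  ...   | inj₁ e       rewrite e = update-≢ var x≢k
  ...   | inj₂ (a , e) rewrite e = refl

  th-assign : ∀ φ ρ k → WellIndexed φ → Th φ → Th (φ ⟦ assign ρ k ⟧)
  th-assign φ ρ zero    wi p = subst Th (sym (sub-var φ)) p
  th-assign φ ρ (suc k) wi p =
    subst Th (sub-sub φ (assign-grounding ρ k) (assign-step ρ k))
      (th-inst (ρ k) (wellIndexed-sub φ wi) (th-assign φ ρ k wi p))

  -- The free variables of φ lie below a bound, so finitely many instantiations suffice.
  th-ground : ∀ φ ρ → WellIndexed φ → Th φ → Th (φ ⟦ elem ∘ ρ ⟧)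
  th-ground φ ρ wi p =
    subst Th (sub-cong φ λ x∈φ → assign-< ρ (proj₁ bound) (fv-below φ (proj₂ bound ≤-refl) x∈φ))
      (th-assign φ ρ (proj₁ bound) wi p)
    where bound = below-eventually φ

  -- The truth lemma. Its two directions are proved together, because the implication case of each
  -- calls the other for the antecedent.
  ⊨⇒th : ∀ φ ρ → WellIndexed φ → Truth model tt φ ρ → Th (φ ⟦ elem ∘ ρ ⟧)
  th⇒⊨ : ∀ φ ρ → WellIndexed φ → Th (φ ⟦ elem ∘ ρ ⟧) → Truth model tt φ ρ

  elem-value : ∀ ρ i → elem (value model ρ i) ≡ subᵢ (elem ∘ ρ) i
  elem-value ρ (var x)  = refl
  elem-value ρ (elem a) = refl

  map-elem-value : ∀ ρ X → map elem (map (value model ρ) X) ≡ map (subᵢ (elem ∘ ρ)) X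
  map-elem-value ρ X = trans (sym (map-∘ X)) (map-cong (elem-value ρ) X)

  atom-value : ∀ ρ P (is : Vec (Ind ℕ) (arity L P)) →
    atom P (Vec.map elem (Vec.map (value model ρ) is)) ≡ atom P (Vec.map (subᵢ (elem ∘ ρ)) is)
  atom-value ρ P is = cong (atom P) (trans (sym (Vec.map-∘ _ _ is)) (Vec.map-cong (elem-value ρ) is))

  sentence-ground : ∀ φ ρ → WellIndexed φ → Sentence (φ ⟦ elem ∘ ρ ⟧)
  sentence-ground φ ρ wi = closed-sub-elem φ ρ , wellIndexed-sub φ wi

  sub-update : ∀ x (φ : Formula L ℕ) ρ a →
    φ ⟦ (elem ∘ ρ) [ x ↦ var x ] ⟧ ⟦ x ≔ elem a ⟧ ≡ φ ⟦ elem ∘ (ρ [ x ↦ a ]) ⟧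
  sub-update x φ ρ a = sub-sub φ (grounding-update (λ y → inj₂ (ρ y , refl)) x) commute
    where
    commute : ∀ y → subᵢ (var [ x ↦ elem a ]) (((elem ∘ ρ) [ x ↦ var x ]) y) ≡ elem ((ρ [ x ↦ a ]) y)
    commute y with y ≟ x
    ... | yes refl rewrite update-≡ (elem ∘ ρ) x {var x} | update-≡ ρ x {a} = update-≡ var x
    ... | no y≢x   rewrite update-≢ (elem ∘ ρ) {i = var x} y≢x | update-≢ ρ {i = a} y≢x = refl

  -- Variables in X already have the value that ρ′ gives them, and the others are left for ρ′ to
  -- fill.
  sub-restrict : ∀ X (φ : Formula L ℕ) ρ ρ′ → (∀ x → var x ∈ X → ρ′ x ≡ ρ x) →
    φ ⟦ (elem ∘ ρ) ↾ X ⟧ ⟦ elem ∘ ρ′ ⟧ ≡ φ ⟦ elem ∘ ρ′ ⟧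
  sub-restrict X φ ρ ρ′ agree = sub-sub φ (grounding-restrict (λ y → inj₂ (ρ y , refl)) X) commute
    where
    commute : ∀ y → subᵢ (elem ∘ ρ′) (((elem ∘ ρ) ↾ X) y) ≡ elem (ρ′ y)
    commute y with y var∈? X
    ... | yes y∈X = cong elem (sym (agree y y∈X))
    ... | no _    = refl

  covers-value : ∀ X φ ρ → (∀ {a} → a occursIn φ → elem a ∈ X) →
    ∀ {a} → a occursIn φ ⟦ (elem ∘ ρ) ↾ X ⟧ → a ∈ map (value model ρ) X
  covers-value X φ ρ X⊇ a∈ with occurs-sub φ a∈
  ... | inj₁ a∈φ = ∈-map⁺ (value model ρ) (X⊇ a∈φ)
  ... | inj₂ (x , e) with x var∈? X
  ...   | yes x∈X with refl ← e = ∈-map⁺ (value model ρ) x∈X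

  ⊨⇒th (atom P is)  ρ wi        p  = subst Th (atom-value ρ P is) p
  ⊨⇒th (φ ⇒ ψ)      ρ (wi , wj) f  =
    th-⇒ (sentence-ground φ ρ wi) (⊨⇒th ψ ρ wj ∘ f ∘ th⇒⊨ φ ρ wi)
  ⊨⇒th (∀[ x ] φ)   ρ wi        f  =
    th-∀ x _ (sentence-ground (∀[ x ] φ) ρ wi) λ a →
      subst Th (sym (sub-update x φ ρ a)) (⊨⇒th φ (ρ [ x ↦ a ]) wi (f a))
  ⊨⇒th (t ∶[ X ] φ) ρ (wi , wj) ((Y , _ , p) , _) =
    -- Evidence comes with some index Y; reindexing replaces it by the values of X, which cover the
    -- elements of the body by well-indexedness.
    subst (λ Z → Th (t ∶[ Z ] (φ ⟦ (elem ∘ ρ) ↾ X ⟧))) (map-elem-value ρ X)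
      (th-reindex Y (map (value model ρ) X) (covers-value X φ ρ wi) p)

  th⇒⊨ (atom P is)  ρ wi        p   = subst Th (sym (atom-value ρ P is)) p
  th⇒⊨ ⊥ᶠ           ρ wi        p   = th-consistent p
  th⇒⊨ (φ ⇒ ψ)      ρ (wi , wj) p q = th⇒⊨ ψ ρ wj (th-mp p (⊨⇒th φ ρ wi q))
  th⇒⊨ (∀[ x ] φ)   ρ wi        p a =
    th⇒⊨ φ (ρ [ x ↦ a ]) wi
      (subst Th (sub-update x φ ρ a) (th-app (der-inst x a _ (wellIndexed-sub φ wi)) p))
  th⇒⊨ (t ∶[ X ] φ) ρ (wi , wj) p =
    ( map (value model ρ) X , covers-value X φ ρ wi
    , subst (λ Z → Th (t ∶[ Z ] (φ ⟦ (elem ∘ ρ) ↾ X ⟧))) (sym (map-elem-value ρ X)) p )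
    -- B1 strips the term. The variables outside X are still free in φ′, and membership in `Th`
    -- allows any values ρ′ for them.
    , λ _ _ ρ′ agree → th⇒⊨ φ ρ′ wj (subst Th (sub-restrict X φ ρ ρ′ agree)
        (th-ground φ′ ρ′ (wellIndexed-sub φ wj)
          (th-app (der-ax {φ = t ∶[ X′ ] φ′ ⇒ φ′} (B1 t _ _)) p)))
    where
    X′ = map (subᵢ (elem ∘ ρ)) X
    φ′ = φ ⟦ (elem ∘ ρ) ↾ X ⟧

-- Completeness

closed-embed : ∀ {L D} (φ : Fml L) → Closed φ → Closed (embed {D = D} φ)
closed-embed φ c x = c x ∘ fv-embed φ

mainTheorem2 : ExcludedMiddle 0ℓ →
    (L : Signature) (CS : ConstantSpecification L) →
    VariantClosed CS → AxiomaticallyAppropriate CS →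
    (φ : Fml L) → Closed φ →
    ((M : FittingModel L) → IsFOLPbModel M → Meets M CS → Valid M φ) →
    CS ⊢ φ
mainTheorem2 em L CS _ _ φ closed valid with em {CS ⊢ φ}
... | yes ⊢φ = ⊢φ
... | no ⊬φ  = contradiction (th-mp th-¬φ th-φ) th-consistent
  where
  open Derivability CS
  open Henkin em CS

  ¬φ : Formula L ℕ
  ¬φ = embed φ ⇒ ⊥ᶠ

  S₀ : Stage
  S₀ = record
    { hyps       = ¬φ ∷ []
    ; sentences  = ((λ { x (inj₁ x∈) → closed-embed φ closed x x∈ }) , wellIndexed-embed φ , tt) ∷ []
    -- The derivation is taken at its own threshold N; `embed φ` has no elements, so `par N` gives
    -- back φ, and double negation elimination proves it.
    ; consistent = λ { (N , d) → ⊬φ (mp (ax (A1-DN φ))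
                       (subst (λ ξ → CS ⊢ (ξ ⇒ ⊥ᶠ) ⇒ ⊥ᶠ) (par-embed N φ) (d ≤-refl))) }
    }

  open Canonical em CS S₀
  open Completion S₀

  th-¬φ : Th ¬φ
  th-¬φ = 0 , ⊩-hyp ¬φ []

  th-φ : Th (embed φ)
  -- Since φ is closed, grounding leaves `embed φ` unchanged; the valuation constantly 0 is an
  -- arbitrary choice.
  th-φ = subst Th (sub-id (embed φ) λ x∈ → contradiction x∈ (closed-embed φ closed _))
    (⊨⇒th (embed φ) (λ _ → 0) (wellIndexed-embed φ)
      (valid model (tt , λ _ _ → tt) (λ s _ → evidence-con s) tt (λ _ → 0)))
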